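{- Let $N$ be a positive integer, let $a\in\{1,2,\ldots,N\}$, and let $r$ be a variable. For formal variables $u,v,w$, we have $$\sum_{\substack{k\geq n+s\\ n\geq s\geq 1}}X_0^r(k,n,s)\,u^{k-n-s}v^{n-s}w^{2s-2}=\frac{1}{(a-\alpha_1)(a-\alpha_2)}\;{}_3F_2\!\left({\frac{a+\beta_1}{N},\ \frac{a+\beta_2}{N},\ 1\atop \frac{a-\alpha_1}{N}+1,\ \frac{a-\alpha_2}{N}+1};\,1\right),$$ where $\alpha_1,\alpha_2$ are determined by $\alpha_1+\alpha_2=u+vr$, $\alpha_1\alpha_2=r(uv-w^2)$, and $\beta_1,\beta_2$ are determined by $\beta_1+\beta_2=-u+v(1-r)$, $\beta_1\beta_2=(r-1)(uv-w^2)$.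
   Context: An index is a finite sequence $\mathbf{k}=(k_1,\ldots,k_n)$ of positive integers. Its weight is $k_1+\cdots+k_n$, its depth is $\operatorname{dep}(\mathbf{k})=n$, and its height is the number of $i$ with $k_i\geq 2$. It is admissible if $k_1>1$. For an admissible index define the multiple $t$-value of level $N$ $$t_{N,a}(\mathbf{k})=\sum_{\substack{m_1>\cdots>m_n>0\\ m_i\equiv a \ (\mathrm{mod}\ N)}}\frac{1}{m_1^{k_1}\cdots m_n^{k_n}}$$ and the interpolated multiple $t$-value of level $N$ $$t_{N,a}^r(\mathbf{k})=\sum_{\mathbf{p}}r^{\,n-\operatorname{dep}(\mathbf{p})}\,t_{N,a}(\mathbf{p}),$$ where $\mathbf{p}$ runs over all $2^{n-1}$ indices obtained from $(k_1\,\Box\, k_2\,\Box\cdots\Box\, k_n)$ by replacing each $\Box$ with either a comma or a plus sign (each choice of replacements counted once). $I_0(k,n,s)$ is the set of all admissible indices of weight $k$, depth $n$ and height $s$, and $X_0^r(k,n,s)=\sum_{\mathbf{k}\in I_0(k,n,s)}t_{N,a}^r(\mathbf{k})$. The generalized hypergeometric function is ${}_3F_2\left({b_1,b_2,b_3\atop c_1,c_2};z\right)=\sum_{n=0}^\infty\frac{(b_1)_n(b_2)_n(b_3)_n}{(c_1)_n(c_2)_n}\frac{z^n}{n!}$, with $(b)_0=1$ and $(b)_n=b(b+1)\cdots(b+n-1)$ for $n>0$. Identities in formal variables are identities of formal power series in $u,v,w$. The right-hand side is symmetric in $\alpha_1,\alpha_2$ and in $\beta_1,\beta_2$; each term of the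 series is expanded as a power series in $u,v,w$, and the series is summed coefficientwise. -}

module Defs where

open import Algebra.Bundles using (RawRing; CommutativeRing)
import Algebra.Definitions.RawSemiring as RawSemiringOps
open import Algebra.Morphism.Structures using (IsRingMonomorphism)
open import Data.Bool.Base using (true; false; if_then_else_)
open import Data.Empty using (⊥; ⊥-elim)
open import Data.Fin.Base using (toℕ)
open import Data.Integer.Base as ℤ using (+_)
import Data.Integer.Properties as ℤ
open import Data.List.Base as List
  using (List; []; _∷_; _++_; [_]; length; filter; upTo; replicate; cartesianProductWith)
import Data.Nat.ListAction as ℕ
open import Data.List.Relation.Unary.All as All using (All; []; _∷_; all?)
open import Data.List.Relation.Unary.All.Properties as All using (all-filter; ++⁺; map⁺)
open import Data.Nat.Base as ℕ using (ℕ; zero; suc; NonZero; _∸_; _!; ⌊_/2⌋)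
import Data.Nat.Coprimality as Coprime
import Data.Nat.Divisibility as ℕ
import Data.Nat.DivMod as ℕ
import Data.Nat.Properties as ℕ
open import Data.Product.Base using (_×_; _,_; ∃-syntax; Σ-syntax; proj₁; proj₂)
open import Data.Rational.Base as ℚ using (ℚ; mkℚ; 0ℚ; 1ℚ; ½; _/_; ∣_∣)
import Data.Rational.Properties as ℚ
import Data.Rational.Solver as ℚ
import Data.Rational.Unnormalised.Base as ℚᵘ
import Data.Rational.Unnormalised.Properties as ℚᵘ
open import Data.Sum.Base using (inj₁; inj₂)
open import Level as Level using (0ℓ)
open import Relation.Binary.PropositionalEquality
  using (_≡_; refl; sym; trans; cong; cong₂; subst; subst₂)
open import Relation.Nullary.Decidable using (Dec; yes; no; does; _×-dec_)

IsCauchy : (ℕ → ℚ) → Set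
IsCauchy x = ∀ ε → 0ℚ ℚ.< ε →
  ∃[ K ] ∀ m n → K ℕ.≤ m → K ℕ.≤ n → ∣ x m ℚ.- x n ∣ ℚ.< ε

record ℝ : Set where
  constructor real
  field
    approx   : ℕ → ℚ
    isCauchy : IsCauchy approx

open ℝ public

-- Convergence of a sequence of rationals to a real: |q m - y| is bounded by
-- every positive ε eventually, where y is given by its approximations.
infix 4 _⟶_
_⟶_ : (ℕ → ℚ) → ℝ → Set
q ⟶ y = ∀ ε → 0ℚ ℚ.< ε →
  ∃[ K ] ∀ m n → K ℕ.≤ m → K ℕ.≤ n → ∣ q m ℚ.- approx y n ∣ ℚ.< ε

0ℝ : ℝ
0ℝ = real (λ _ → 0ℚ) (λ _ 0<ε → 0 , λ _ _ _ _ → 0<ε)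

private
  half-pos : ∀ {ε} → 0ℚ ℚ.< ε → 0ℚ ℚ.< ½ ℚ.* ε
  half-pos {ε} 0<ε = subst (ℚ._< ½ ℚ.* ε) (ℚ.*-zeroʳ ½) (ℚ.*-monoʳ-<-pos ½ {0ℚ} {ε} 0<ε)

  halves : ∀ ε → ½ ℚ.* ε ℚ.+ ½ ℚ.* ε ≡ ε
  halves ε = trans (sym (ℚ.*-distribʳ-+ ε ½ ½)) (ℚ.*-identityˡ ε)

  interchange : ∀ p q p′ q′ → (p ℚ.+ q) ℚ.- (p′ ℚ.+ q′) ≡ (p ℚ.- p′) ℚ.+ (q ℚ.- q′)
  interchange = solve 4 (λ a b c d → (a :+ b) :- (c :+ d) := (a :- c) :+ (b :- d)) refl
    where open ℚ.+-*-Solver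

  close-+ : ∀ {ε} p q p′ q′ → ∣ p ℚ.- p′ ∣ ℚ.< ½ ℚ.* ε → ∣ q ℚ.- q′ ∣ ℚ.< ½ ℚ.* ε →
            ∣ (p ℚ.+ q) ℚ.- (p′ ℚ.+ q′) ∣ ℚ.< ε
  close-+ {ε} p q p′ q′ <₁ <₂ = begin-strict
    ∣ (p ℚ.+ q) ℚ.- (p′ ℚ.+ q′) ∣    ≡⟨ cong ∣_∣ (interchange p q p′ q′) ⟩
    ∣ (p ℚ.- p′) ℚ.+ (q ℚ.- q′) ∣    ≤⟨ ℚ.∣p+q∣≤∣p∣+∣q∣ (p ℚ.- p′) (q ℚ.- q′) ⟩
    ∣ p ℚ.- p′ ∣ ℚ.+ ∣ q ℚ.- q′ ∣    <⟨ ℚ.+-mono-< <₁ <₂ ⟩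
    ½ ℚ.* ε ℚ.+ ½ ℚ.* ε              ≡⟨ halves ε ⟩
    ε ∎
    where open ℚ.≤-Reasoning

+-isCauchy : ∀ {x y} → IsCauchy x → IsCauchy y → IsCauchy (λ m → x m ℚ.+ y m)
+-isCauchy {x} {y} cx cy ε 0<ε with cx (½ ℚ.* ε) (half-pos 0<ε) | cy (½ ℚ.* ε) (half-pos 0<ε)
... | K , x-close | L , y-close = K ℕ.+ L , λ m n K+L≤m K+L≤n →
  close-+ (x m) (y m) (x n) (y n)
    (x-close m n (ℕ.m+n≤o⇒m≤o K K+L≤m) (ℕ.m+n≤o⇒m≤o K K+L≤n))
    (y-close m n (ℕ.m+n≤o⇒n≤o K K+L≤m) (ℕ.m+n≤o⇒n≤o K K+L≤n))

infixl 6 _+ℝ_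
_+ℝ_ : ℝ → ℝ → ℝ
x +ℝ y = real (λ m → approx x m ℚ.+ approx y m)
  (+-isCauchy {approx x} {approx y} (isCauchy x) (isCauchy y))

-- Polynomials in r are lists of coefficients in increasing degree; trailing
-- zeros are allowed.

coeff : ∀ {A : Set} → A → List A → ℕ → A
coeff 0# []       d       = 0#
coeff 0# (x ∷ p)  zero    = x
coeff 0# (x ∷ p)  (suc d) = coeff 0# p d

addCoeffs : ∀ {A : Set} → (A → A → A) → List A → List A → List A
addCoeffs _+_ []      q       = q
addCoeffs _+_ (x ∷ p) []      = x ∷ p
addCoeffs _+_ (x ∷ p) (y ∷ q) = (x + y) ∷ addCoeffs _+_ p q

-- x·r^d
monomial : ∀ {A : Set} → A → ℕ → A → List A
monomial 0# d x = replicate d 0# ++ [ x ]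

mulCoeffs : List ℚ → List ℚ → List ℚ
mulCoeffs []      q = []
mulCoeffs (x ∷ p) q = addCoeffs ℚ._+_ (List.map (x ℚ.*_) q) (0ℚ ∷ mulCoeffs p q)

ℚ[r] : RawRing 0ℓ 0ℓ
ℚ[r] = record
  { Carrier = List ℚ
  ; _≈_     = λ p q → ∀ d → coeff 0ℚ p d ≡ coeff 0ℚ q d
  ; _+_     = addCoeffs ℚ._+_
  ; _*_     = mulCoeffs
  ; -_      = List.map (λ x → ℚ.- x)
  ; 0#      = []
  ; 1#      = [ 1ℚ ]
  }

ℝ[r] : Set
ℝ[r] = List ℝ

_+ℝ[r]_ : ℝ[r] → ℝ[r] → ℝ[r]
_+ℝ[r]_ = addCoeffs _+ℝ_

Σℝ[r] : List ℝ[r] → ℝ[r]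
Σℝ[r] = List.foldr _+ℝ[r]_ []

module PowerSeries (R : RawRing 0ℓ 0ℓ) where
  open RawRing R
  open RawSemiringOps rawSemiring using (sum)

  constant : Carrier → ℕ → Carrier
  constant c zero    = c
  constant c (suc _) = 0#

  series : RawRing 0ℓ 0ℓ
  series = record
    { Carrier = ℕ → Carrier
    ; _≈_     = λ f g → ∀ n → f n ≈ g n
    ; _+_     = λ f g n → f n + g n
    ; _*_     = λ f g n → sum {suc n} (λ i → f (toℕ i) * g (n ∸ toℕ i))
    ; -_      = λ f n → - f n
    ; 0#      = λ _ → 0#
    ; 1#      = constant 1#
    }

  X : ℕ → Carrier
  X zero          = 0#
  X (suc zero)    = 1#
  X (suc (suc _)) = 0#

private
  module W = PowerSeries ℚ[r]
  module V = PowerSeries W.series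
  module U = PowerSeries V.series

-- f i j l is the coefficient of u^i v^j w^l.
ℚ[r]⟦u,v,w⟧ : RawRing 0ℓ 0ℓ
ℚ[r]⟦u,v,w⟧ = U.series

open RawRing ℚ[r]⟦u,v,w⟧ public using () renaming (Carrier to Series)

fromℚ[r] : List ℚ → Series
fromℚ[r] p = U.constant (V.constant (W.constant p))

fromℚ : ℚ → Series
fromℚ q = fromℚ[r] [ q ]

u v w r : Series
u = U.X
v = U.constant V.X
w = U.constant (V.constant W.X)
r = fromℚ[r] (0ℚ ∷ 1ℚ ∷ [])

ℝ[r]⟦u,v,w⟧ : Set
ℝ[r]⟦u,v,w⟧ = ℕ → ℕ → ℕ → ℝ[r]

-- Σ_m T m = f, summed coefficientwise (for each monomial u^i v^j w^l r^d).
_SumsTo_ : (ℕ → Series) → ℝ[r]⟦u,v,w⟧ → Set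
T SumsTo f = ∀ i j l d →
  (λ M → coeff 0ℚ (sum {M} (λ m → T (toℕ m)) i j l) d) ⟶ coeff 0ℝ (f i j l) d
  where open RawSemiringOps (RawRing.rawSemiring ℚ[r]⟦u,v,w⟧) using (sum)

weight height : List ℕ → ℕ
weight = ℕ.sum
height κ = length (filter (2 ℕ.≤?_) κ)

IsIndex : List ℕ → Set
IsIndex = All NonZero

Admissible : List ℕ → Set
Admissible []       = ⊥
Admissible (k ∷ ks) = 1 ℕ.< k × IsIndex ks

admissible? : ∀ κ → Dec (Admissible κ)
admissible? []       = no λ ()
admissible? (k ∷ ks) = (1 ℕ.<? k) ×-dec all? ℕ.nonZero? ks

-- All indices obtained from (k □ l₁ □ ⋯ □ lₙ₋₁) by replacing each □ by a comma
-- or a plus sign, one list entry for each choice of replacements.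
merges : ℕ → List ℕ → List (List ℕ)
merges k []       = [ [ k ] ]
merges k (l ∷ ls) = List.map (k ∷_) (merges l ls) ++ merges (k ℕ.+ l) ls

merges-isIndex : ∀ {k ls} → NonZero k → IsIndex ls → All IsIndex (merges k ls)
merges-isIndex             k≢0 []           = (k≢0 ∷ []) ∷ []
merges-isIndex {suc k} {l ∷ ls} k≢0 (l≢0 ∷ ls≢0) =
  ++⁺ (map⁺ (All.map (k≢0 ∷_) (merges-isIndex l≢0 ls≢0)))
      (merges-isIndex {suc k ℕ.+ l} _ ls≢0)

merges-admissible : ∀ {k ls} → Admissible (k ∷ ls) → All Admissible (merges k ls)
merges-admissible (1<k , [])           = (1<k , []) ∷ []
merges-admissible (1<k , (l≢0 ∷ ls≢0)) =
  ++⁺ (map⁺ (All.map (1<k ,_) (merges-isIndex l≢0 ls≢0)))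
      (merges-admissible (ℕ.≤-trans 1<k (ℕ.m≤m+n _ _) , ls≢0))

IsI₀ : (k n s : ℕ) → List ℕ → Set
IsI₀ k n s κ = Admissible κ × weight κ ≡ k × length κ ≡ n × height κ ≡ s

isI₀? : ∀ k n s κ → Dec (IsI₀ k n s κ)
isI₀? k n s κ = admissible? κ ×-dec (weight κ ℕ.≟ k) ×-dec (length κ ℕ.≟ n) ×-dec (height κ ℕ.≟ s)

words : ∀ {A : Set} → ℕ → List A → List (List A)
words zero    xs = [ [] ]
words (suc n) xs = cartesianProductWith _∷_ xs (words n xs)

-- The entries of an index of weight k are at most k, so this enumerates the
-- whole set, without repetition.
I₀ : (k n s : ℕ) → List (List ℕ)
I₀ k n s = filter (isI₀? k n s) (words n (upTo (suc k)))

I₀-sound : ∀ k n s → All (IsI₀ k n s) (I₀ k n s)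
I₀-sound k n s = all-filter (isI₀? k n s) (words n (upTo (suc k)))

module _ (N a : ℕ) .{{_ : NonZero N}} where

  -- The sum of 1 / (m₁^k₁ ⋯ mₙ^kₙ) over M ≥ m₁ > ⋯ > mₙ > 0 with every
  -- mᵢ ≡ a (mod N).
  truncated-t : List ℕ → ℕ → ℚ
  truncated-t []       M       = 1ℚ
  truncated-t (k ∷ ks) zero    = 0ℚ
  truncated-t (k ∷ ks) (suc m) = truncated-t (k ∷ ks) m ℚ.+
    (if does (suc m ℕ.% N ℕ.≟ a ℕ.% N)
     then (+ 1 / (suc m ℕ.^ k)) {{ℕ.m^n≢0 (suc m) k}} ℚ.* truncated-t ks m
     else 0ℚ)

-- Convergence for admissible indices.  V (suc d) m is the sum of
-- 1 / (m₁ ⋯ mⱼ) over m ≥ m₁ > ⋯ > mⱼ > 0 and j ≤ d.  It bounds truncated-t at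
-- depth d, the sequence truncated-t (k ∷ ks) m + V (suc d) m / m decreases, and
-- V (suc d) m / m tends to 0.
private module Convergence where
  open ℚ.≤-Reasoning
  open ℚ.+-*-Solver using (solve; _:+_; _:*_; _:-_; :-_; _:=_)

  opaque
    nat : ℕ → ℚ
    nat n = mkℚ (+ n) 0 (Coprime.sym (Coprime.1-coprimeTo n))

    nat-+ : ∀ m n → nat (m ℕ.+ n) ≡ nat m ℚ.+ nat n
    nat-+ m n = ℚ.toℚᵘ-injective (ℚᵘ.≃-trans lemma (ℚᵘ.≃-sym (ℚ.toℚᵘ-homo-+ (nat m) (nat n))))
      where
      lemma : ℚ.toℚᵘ (nat (m ℕ.+ n)) ℚᵘ.≃ ℚ.toℚᵘ (nat m) ℚᵘ.+ ℚ.toℚᵘ (nat n)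
      lemma = ℚᵘ.*≡* (cong (ℤ._* + 1)
        (trans (ℤ.pos-+ m n) (sym (cong₂ ℤ._+_ (ℤ.*-identityʳ (+ m)) (ℤ.*-identityʳ (+ n))))))

    nat-≤ : ∀ {m n} → m ℕ.≤ n → nat m ℚ.≤ nat n
    nat-≤ {m} {n} m≤n = ℚ.*≤* (subst₂ ℤ._≤_ (sym (ℤ.*-identityʳ (+ m))) (sym (ℤ.*-identityʳ (+ n)))
                                (ℤ.+≤+ m≤n))

    0≤nat : ∀ n → 0ℚ ℚ.≤ nat n
    0≤nat n = ℚ.nonNegative⁻¹ (nat n)

    nat-1 : nat 1 ≡ 1ℚ
    nat-1 = refl

    ceiling : ∀ q → ∃[ n ] q ℚ.≤ nat n
    ceiling q@(mkℚ (+ n) d _) = n , ℚ.*≤* (subst₂ ℤ._≤_ (sym (ℤ.*-identityʳ (+ n)))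
      (ℤ.pos-* n (suc d)) (ℤ.+≤+ (ℕ.m≤m*n n (suc d))))
    ceiling q@(mkℚ (ℤ.-[1+ n ]) d _) = 0 , ℚ.*≤* ℤ.-≤+

    inverse : ∀ n .{{_ : NonZero n}} → nat n ℚ.* (+ 1 / n) ≡ 1ℚ
    inverse (suc m) = ℚ.toℚᵘ-injective (ℚᵘ.≃-trans (ℚ.toℚᵘ-homo-* (nat (suc m)) (+ 1 / suc m))
      (ℚᵘ.≃-trans {j = ℚ.toℚᵘ (nat (suc m)) ℚᵘ.* ℚᵘ.mkℚᵘ (+ 1) m}
        (ℚᵘ.*-congˡ {ℚ.toℚᵘ (nat (suc m))} (ℚ.toℚᵘ-fromℚᵘ (ℚᵘ.mkℚᵘ (+ 1) m)))
        (ℚᵘ.*≡* (cong +_ (trans (ℕ.*-identityʳ _) (trans (ℕ.*-identityʳ (suc m))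
          (sym (trans (ℕ.*-identityˡ _) (ℕ.*-identityˡ (suc m))))))))))

    nat-* : ∀ m n → nat (m ℕ.* n) ≡ nat m ℚ.* nat n
    nat-* m n = ℚ.toℚᵘ-injective (ℚᵘ.≃-trans (ℚᵘ.*≡* (cong (ℤ._* + 1) (ℤ.pos-* m n)))
      (ℚᵘ.≃-sym (ℚ.toℚᵘ-homo-* (nat m) (nat n))))

  nat-suc : ∀ m → nat (suc m) ≡ nat m ℚ.+ 1ℚ
  nat-suc m = trans (cong nat (ℕ.+-comm 1 m)) (trans (nat-+ m 1) (cong (nat m ℚ.+_) nat-1))

  0≤1 : 0ℚ ℚ.≤ 1ℚ
  0≤1 = ℚ.nonNegative⁻¹ 1ℚ

  +-nonNeg : ∀ {p q} → 0ℚ ℚ.≤ p → 0ℚ ℚ.≤ q → 0ℚ ℚ.≤ p ℚ.+ q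
  +-nonNeg = ℚ.+-mono-≤

  *-mono-≤ : ∀ {p p′ q q′} → 0ℚ ℚ.≤ p′ → 0ℚ ℚ.≤ q → p ℚ.≤ p′ → q ℚ.≤ q′ → p ℚ.* q ℚ.≤ p′ ℚ.* q′
  *-mono-≤ {p} {p′} {q} {q′} 0≤p′ 0≤q p≤p′ q≤q′ = ℚ.≤-trans
    (ℚ.*-monoʳ-≤-nonNeg q {{ℚ.nonNegative 0≤q}} p≤p′)
    (ℚ.*-monoˡ-≤-nonNeg p′ {{ℚ.nonNegative 0≤p′}} q≤q′)

  *-nonNeg : ∀ {p q} → 0ℚ ℚ.≤ p → 0ℚ ℚ.≤ q → 0ℚ ℚ.≤ p ℚ.* q
  *-nonNeg {p} {q} 0≤p 0≤q = subst (ℚ._≤ p ℚ.* q) (ℚ.*-zeroˡ q) (*-mono-≤ 0≤p 0≤q 0≤p ℚ.≤-refl)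

  1/-nonNeg : ∀ n .{{_ : NonZero n}} → 0ℚ ℚ.≤ + 1 / n
  1/-nonNeg n = ℚ.nonNegative⁻¹ (+ 1 / n) {{ℚ.normalize-nonNeg 1 n}}

  1/-antitone : ∀ m n .{{_ : NonZero m}} .{{_ : NonZero n}} → m ℕ.≤ n → + 1 / n ℚ.≤ + 1 / m
  1/-antitone m n m≤n = begin
    + 1 / n                               ≡⟨ ℚ.*-identityʳ (+ 1 / n) ⟨
    + 1 / n ℚ.* 1ℚ                        ≡⟨ cong (+ 1 / n ℚ.*_) (inverse m) ⟨
    + 1 / n ℚ.* (nat m ℚ.* (+ 1 / m))
      ≤⟨ ℚ.*-monoˡ-≤-nonNeg (+ 1 / n) {{ℚ.nonNegative (1/-nonNeg n)}}
           (ℚ.*-monoʳ-≤-nonNeg (+ 1 / m) {{ℚ.nonNegative (1/-nonNeg m)}} (nat-≤ m≤n)) ⟩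
    + 1 / n ℚ.* (nat n ℚ.* (+ 1 / m))
      ≡⟨ solve 3 (λ a b c → a :* (b :* c) := (b :* a) :* c) refl (+ 1 / n) (nat n) (+ 1 / m) ⟩
    nat n ℚ.* (+ 1 / n) ℚ.* (+ 1 / m)     ≡⟨ cong (ℚ._* (+ 1 / m)) (inverse n) ⟩
    1ℚ ℚ.* (+ 1 / m)                      ≡⟨ ℚ.*-identityˡ (+ 1 / m) ⟩
    + 1 / m ∎

  inverse-² : ∀ n z x → n ℚ.* x ≡ 1ℚ → n ℚ.* n ℚ.* z ≡ 1ℚ → z ≡ x ℚ.* x
  inverse-² n z x nx≡1 n²z≡1 = begin-equality
    z                                ≡⟨ ℚ.*-identityʳ z ⟨
    z ℚ.* 1ℚ                         ≡⟨ cong (λ q → z ℚ.* (q ℚ.* q)) nx≡1 ⟨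
    z ℚ.* ((n ℚ.* x) ℚ.* (n ℚ.* x))
      ≡⟨ solve 3 (λ n z x → z :* ((n :* x) :* (n :* x)) := ((n :* n) :* z) :* (x :* x)) refl n z x ⟩
    n ℚ.* n ℚ.* z ℚ.* (x ℚ.* x)      ≡⟨ cong (ℚ._* (x ℚ.* x)) n²z≡1 ⟩
    1ℚ ℚ.* (x ℚ.* x)                 ≡⟨ ℚ.*-identityˡ (x ℚ.* x) ⟩
    x ℚ.* x ∎

  opaque
    1/suc : ℕ → ℚ
    1/suc m = + 1 / suc m

    0≤1/suc : ∀ m → 0ℚ ℚ.≤ 1/suc m
    0≤1/suc m = 1/-nonNeg (suc m)

    suc*1/suc : ∀ m → nat (suc m) ℚ.* 1/suc m ≡ 1ℚ
    suc*1/suc m = inverse (suc m)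

    1/suc-antitone : ∀ m → 1/suc (suc m) ℚ.≤ 1/suc m
    1/suc-antitone m = 1/-antitone (suc m) (suc (suc m)) (ℕ.n≤1+n _)

    1/pow : ℕ → ℕ → ℚ
    1/pow m k = (+ 1 / (suc m ℕ.^ k)) {{ℕ.m^n≢0 (suc m) k}}

    1/pow-def : ∀ m k → (+ 1 / (suc m ℕ.^ k)) {{ℕ.m^n≢0 (suc m) k}} ≡ 1/pow m k
    1/pow-def m k = refl

    0≤1/pow : ∀ m k → 0ℚ ℚ.≤ 1/pow m k
    0≤1/pow m k = 1/-nonNeg (suc m ℕ.^ k) {{ℕ.m^n≢0 (suc m) k}}

    1/pow≤ : ∀ m k → NonZero k → 1/pow m k ℚ.≤ 1/suc m
    1/pow≤ m (suc k) _ = 1/-antitone (suc m) (suc m ℕ.^ suc k) {{_}} {{ℕ.m^n≢0 (suc m) (suc k)}}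
      (ℕ.m≤m*n (suc m) (suc m ℕ.^ k) {{ℕ.m^n≢0 (suc m) k}})

    1/pow≤² : ∀ m k → 1 ℕ.< k → 1/pow m k ℚ.≤ 1/suc m ℚ.* 1/suc m
    1/pow≤² m (suc zero) (ℕ.s≤s ())
    1/pow≤² m (suc (suc k)) _ = subst (1/pow m (2 ℕ.+ k) ℚ.≤_)
      (inverse-² (nat (suc m)) (+ 1 / (suc m ℕ.* suc m)) (1/suc m) (inverse (suc m))
        (trans (cong (ℚ._* (+ 1 / (suc m ℕ.* suc m))) (sym (nat-* (suc m) (suc m))))
          (inverse (suc m ℕ.* suc m))))
      (1/-antitone (suc m ℕ.* suc m) (suc m ℕ.^ (2 ℕ.+ k)) {{_}} {{ℕ.m^n≢0 (suc m) (2 ℕ.+ k)}}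
        (ℕ.*-monoʳ-≤ (suc m) (ℕ.m≤m*n (suc m) (suc m ℕ.^ k) {{ℕ.m^n≢0 (suc m) k}})))

  grow : ∀ p {q} → 0ℚ ℚ.≤ q → p ℚ.≤ p ℚ.+ q
  grow p {q} 0≤q = subst (ℚ._≤ p ℚ.+ q) (ℚ.+-identityʳ p) (ℚ.+-monoʳ-≤ p {0ℚ} {q} 0≤q)

  halve : ∀ p q → p ℚ.+ p ℚ.≤ q ℚ.+ q → p ℚ.≤ q
  halve p q 2p≤2q with p ℚ.≤? q
  ... | yes p≤q = p≤q
  ... | no  p≰q = ⊥-elim (ℚ.<-irrefl refl
                    (ℚ.<-≤-trans (ℚ.+-mono-< (ℚ.≰⇒> p≰q) (ℚ.≰⇒> p≰q)) 2p≤2q))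

  ratio : ∀ {p q} m → p ℚ.≤ q → 1/suc m ℚ.* p ℚ.≤ 1/suc m ℚ.* q
  ratio {p} {q} m = ℚ.*-monoˡ-≤-nonNeg (1/suc m) {{ℚ.nonNegative (0≤1/suc m)}} {p} {q}

  ratio≤1 : ∀ k C m p → nat (k ℕ.+ k) ℚ.* p ℚ.≤ nat (C ℕ.+ suc m) → C ℕ.≤ suc m →
            1/suc m ℚ.* (nat k ℚ.* p) ℚ.≤ 1ℚ
  ratio≤1 k C m p bound C≤1+m = begin
    1/suc m ℚ.* (nat k ℚ.* p)
      ≤⟨ ratio m (halve (nat k ℚ.* p) (nat (suc m)) (begin
           nat k ℚ.* p ℚ.+ nat k ℚ.* p  ≡⟨ ℚ.*-distribʳ-+ p (nat k) (nat k) ⟨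
           (nat k ℚ.+ nat k) ℚ.* p      ≡⟨ cong (ℚ._* p) (nat-+ k k) ⟨
           nat (k ℕ.+ k) ℚ.* p          ≤⟨ bound ⟩
           nat (C ℕ.+ suc m)            ≤⟨ nat-≤ (ℕ.+-monoˡ-≤ (suc m) C≤1+m) ⟩
           nat (suc m ℕ.+ suc m)        ≡⟨ nat-+ (suc m) (suc m) ⟩
           nat (suc m) ℚ.+ nat (suc m) ∎)) ⟩
    1/suc m ℚ.* nat (suc m)  ≡⟨ ℚ.*-comm (1/suc m) (nat (suc m)) ⟩
    nat (suc m) ℚ.* 1/suc m  ≡⟨ suc*1/suc m ⟩
    1ℚ ∎

  V : ℕ → ℕ → ℚ
  V zero    m       = 0ℚ
  V (suc d) zero    = 1ℚ
  V (suc d) (suc m) = V (suc d) m ℚ.+ 1/suc m ℚ.* V d m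

  0≤V : ∀ d m → 0ℚ ℚ.≤ V d m
  0≤V zero    m       = ℚ.≤-refl
  0≤V (suc d) zero    = 0≤1
  0≤V (suc d) (suc m) = +-nonNeg {V (suc d) m} {1/suc m ℚ.* V d m}
    (0≤V (suc d) m) (*-nonNeg {1/suc m} {V d m} (0≤1/suc m) (0≤V d m))

  V-mono : ∀ d {m n} → m ℕ.≤′ n → V d m ℚ.≤ V d n
  V-mono d       ℕ.≤′-refl       = ℚ.≤-refl
  V-mono zero    (ℕ.≤′-step m≤n) = ℚ.≤-refl
  V-mono (suc d) (ℕ.≤′-step {n} m≤n) = ℚ.≤-trans (V-mono (suc d) m≤n)
    (grow (V (suc d) n) {1/suc n ℚ.* V d n}
      (*-nonNeg {1/suc n} {V d n} (0≤1/suc n) (0≤V d n)))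

  V-sublinear : ∀ d k → ∃[ C ] ∀ m → nat k ℚ.* V d m ℚ.≤ nat (C ℕ.+ m)
  V-sublinear zero    k = 0 , λ m → subst (ℚ._≤ nat m) (sym (ℚ.*-zeroʳ (nat k))) (0≤nat m)
  V-sublinear (suc d) k = C , bound
    where
    K = proj₁ (V-sublinear d (k ℕ.+ k))
    C = proj₁ (ceiling (nat k ℚ.* V (suc d) K))

    increment : ∀ m → K ℕ.≤ m → 1/suc m ℚ.* (nat k ℚ.* V d m) ℚ.≤ 1ℚ
    increment m K≤m = ratio≤1 k K m (V d m)
      (ℚ.≤-trans (proj₂ (V-sublinear d (k ℕ.+ k)) m) (nat-≤ (ℕ.+-monoʳ-≤ K (ℕ.n≤1+n m))))
      (ℕ.m≤n⇒m≤1+n K≤m)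

    early : ∀ m → m ℕ.≤ K → nat k ℚ.* V (suc d) m ℚ.≤ nat (C ℕ.+ m)
    early m m≤K = begin
      nat k ℚ.* V (suc d) m  ≤⟨ ℚ.*-monoˡ-≤-nonNeg (nat k) {{ℚ.nonNegative (0≤nat k)}} (V-mono (suc d) (ℕ.≤⇒≤′ m≤K)) ⟩
      nat k ℚ.* V (suc d) K  ≤⟨ proj₂ (ceiling (nat k ℚ.* V (suc d) K)) ⟩
      nat C                  ≤⟨ nat-≤ (ℕ.m≤m+n C m) ⟩
      nat (C ℕ.+ m) ∎

    bound : ∀ m → nat k ℚ.* V (suc d) m ℚ.≤ nat (C ℕ.+ m)
    bound zero    = early zero ℕ.z≤n
    bound (suc m) with ℕ.≤-total (suc m) K
    ... | inj₁ 1+m≤K = early (suc m) 1+m≤K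
    ... | inj₂ K≤1+m with ℕ.m≤n⇒m<n∨m≡n K≤1+m
    ...   | inj₂ K≡1+m = early (suc m) (ℕ.≤-reflexive (sym K≡1+m))
    ...   | inj₁ (ℕ.s≤s K≤m) = begin
      nat k ℚ.* (V (suc d) m ℚ.+ 1/suc m ℚ.* V d m)
        ≡⟨ solve 4 (λ a b c e → a :* (b :+ c :* e) := a :* b :+ c :* (a :* e)) refl
             (nat k) (V (suc d) m) (1/suc m) (V d m) ⟩
      nat k ℚ.* V (suc d) m ℚ.+ 1/suc m ℚ.* (nat k ℚ.* V d m)
        ≤⟨ ℚ.+-mono-≤ (bound m) (increment m K≤m) ⟩
      nat (C ℕ.+ m) ℚ.+ 1ℚ     ≡⟨ nat-suc (C ℕ.+ m) ⟨
      nat (suc (C ℕ.+ m))      ≡⟨ cong nat (ℕ.+-suc C m) ⟨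
      nat (C ℕ.+ suc m) ∎

  if-≤ : ∀ b {c} → 0ℚ ℚ.≤ c → (if b then c else 0ℚ) ℚ.≤ c
  if-≤ true  0≤c = ℚ.≤-refl
  if-≤ false 0≤c = 0≤c

  if-nonNeg : ∀ b {c} → 0ℚ ℚ.≤ c → 0ℚ ℚ.≤ (if b then c else 0ℚ)
  if-nonNeg true  0≤c = 0≤c
  if-nonNeg false 0≤c = ℚ.≤-refl

  module _ (N a : ℕ) .{{_ : NonZero N}} where

    t : List ℕ → ℕ → ℚ
    t = truncated-t N a

    summand : ℕ → List ℕ → ℕ → ℚ
    summand k ks m = if does (suc m ℕ.% N ℕ.≟ a ℕ.% N) then 1/pow m k ℚ.* t ks m else 0ℚ

    t-suc : ∀ k ks m → t (k ∷ ks) (suc m) ≡ t (k ∷ ks) m ℚ.+ summand k ks m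
    t-suc k ks m = cong (λ q → t (k ∷ ks) m ℚ.+
      (if does (suc m ℕ.% N ℕ.≟ a ℕ.% N) then q ℚ.* t ks m else 0ℚ)) (1/pow-def m k)

    t-nonNeg : ∀ ks m → 0ℚ ℚ.≤ t ks m
    0≤product : ∀ k ks m → 0ℚ ℚ.≤ 1/pow m k ℚ.* t ks m
    0≤summand : ∀ k ks m → 0ℚ ℚ.≤ summand k ks m

    t-nonNeg []       m       = 0≤1
    t-nonNeg (k ∷ ks) zero    = ℚ.≤-refl
    t-nonNeg (k ∷ ks) (suc m) = subst (0ℚ ℚ.≤_) (sym (t-suc k ks m))
      (+-nonNeg {t (k ∷ ks) m} {summand k ks m} (t-nonNeg (k ∷ ks) m) (0≤summand k ks m))

    0≤product k ks m = *-nonNeg {1/pow m k} {t ks m} (0≤1/pow m k) (t-nonNeg ks m)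

    0≤summand k ks m =
      if-nonNeg (does (suc m ℕ.% N ℕ.≟ a ℕ.% N)) {1/pow m k ℚ.* t ks m} (0≤product k ks m)

    t-step : ∀ k ks m → t (k ∷ ks) (suc m) ℚ.≤ t (k ∷ ks) m ℚ.+ 1/pow m k ℚ.* t ks m
    t-step k ks m = subst (ℚ._≤ t (k ∷ ks) m ℚ.+ 1/pow m k ℚ.* t ks m) (sym (t-suc k ks m))
      (ℚ.+-monoʳ-≤ (t (k ∷ ks) m) {summand k ks m} {1/pow m k ℚ.* t ks m}
        (if-≤ (does (suc m ℕ.% N ℕ.≟ a ℕ.% N)) {1/pow m k ℚ.* t ks m} (0≤product k ks m)))

    t-mono : ∀ k ks {m n} → m ℕ.≤′ n → t (k ∷ ks) m ℚ.≤ t (k ∷ ks) n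
    t-mono k ks ℕ.≤′-refl = ℚ.≤-refl
    t-mono k ks (ℕ.≤′-step {n} m≤n) = ℚ.≤-trans (t-mono k ks m≤n)
      (subst (t (k ∷ ks) n ℚ.≤_) (sym (t-suc k ks n))
        (grow (t (k ∷ ks) n) {summand k ks n} (0≤summand k ks n)))

    t-bound : ∀ {ks} → IsIndex ks → ∀ m → t ks m ℚ.+ V (length ks) m ℚ.≤ V (suc (length ks)) m
    t-bound [] zero    = ℚ.≤-refl
    t-bound [] (suc m) = ℚ.≤-trans (t-bound [] m) (V-mono 1 {m} {suc m} (ℕ.≤′-step ℕ.≤′-refl))
    t-bound {k ∷ ks} (k≢0 ∷ ks≢0) zero = ℚ.≤-reflexive (ℚ.+-identityˡ 1ℚ)
    t-bound {k ∷ ks} (k≢0 ∷ ks≢0) (suc m) = begin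
      t (k ∷ ks) (suc m) ℚ.+ (V (suc d) m ℚ.+ 1/suc m ℚ.* V d m)
        ≤⟨ ℚ.+-monoˡ-≤ _ (t-step k ks m) ⟩
      t (k ∷ ks) m ℚ.+ 1/pow m k ℚ.* t ks m ℚ.+ (V (suc d) m ℚ.+ 1/suc m ℚ.* V d m)
        ≤⟨ ℚ.+-monoˡ-≤ _ (ℚ.+-monoʳ-≤ (t (k ∷ ks) m)
             (ℚ.*-monoʳ-≤-nonNeg (t ks m) {{ℚ.nonNegative (t-nonNeg ks m)}} (1/pow≤ m k k≢0))) ⟩
      t (k ∷ ks) m ℚ.+ 1/suc m ℚ.* t ks m ℚ.+ (V (suc d) m ℚ.+ 1/suc m ℚ.* V d m)
        ≡⟨ solve 5 (λ p y q b c → (p :+ y :* q) :+ (b :+ y :* c) := (p :+ b) :+ y :* (q :+ c)) refl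
             (t (k ∷ ks) m) (1/suc m) (t ks m) (V (suc d) m) (V d m) ⟩
      (t (k ∷ ks) m ℚ.+ V (suc d) m) ℚ.+ 1/suc m ℚ.* (t ks m ℚ.+ V d m)
        ≤⟨ ℚ.+-mono-≤ (t-bound (k≢0 ∷ ks≢0) m)
             (ℚ.*-monoˡ-≤-nonNeg (1/suc m) {{ℚ.nonNegative (0≤1/suc m)}} (t-bound ks≢0 m)) ⟩
      V (suc (suc d)) m ℚ.+ 1/suc m ℚ.* V (suc d) m ∎
      where d = length ks

    reciprocals : ∀ m → 1/suc (suc m) ℚ.+ 1/suc (suc m) ℚ.* 1/suc (suc m) ℚ.≤ 1/suc m
    reciprocals m = begin
      z ℚ.+ z ℚ.* z  ≤⟨ ℚ.+-monoʳ-≤ z (ratio (suc m) (1/suc-antitone m)) ⟩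
      z ℚ.+ z ℚ.* y
        ≡⟨ cong (ℚ._+ z ℚ.* y) (trans (cong (ℚ._* z) (suc*1/suc m)) (ℚ.*-identityˡ z)) ⟨
      n ℚ.* y ℚ.* z ℚ.+ z ℚ.* y
        ≡⟨ solve 3 (λ n y z → n :* y :* z :+ z :* y := y :* (n :* z :+ z)) refl n y z ⟩
      y ℚ.* (n ℚ.* z ℚ.+ z)         ≡⟨ cong (λ q → y ℚ.* (n ℚ.* z ℚ.+ q)) (ℚ.*-identityˡ z) ⟨
      y ℚ.* (n ℚ.* z ℚ.+ 1ℚ ℚ.* z)  ≡⟨ cong (y ℚ.*_) (ℚ.*-distribʳ-+ z n 1ℚ) ⟨
      y ℚ.* ((n ℚ.+ 1ℚ) ℚ.* z)      ≡⟨ cong (λ q → y ℚ.* (q ℚ.* z)) (nat-suc (suc m)) ⟨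
      y ℚ.* (nat (suc (suc m)) ℚ.* z)  ≡⟨ cong (y ℚ.*_) (suc*1/suc (suc m)) ⟩
      y ℚ.* 1ℚ                         ≡⟨ ℚ.*-identityʳ y ⟩
      y ∎
      where
      n = nat (suc m)
      y = 1/suc m
      z = 1/suc (suc m)

    module _ {k : ℕ} {ks : List ℕ} (1<k : 1 ℕ.< k) (ks≢0 : IsIndex ks) where
      d = length ks

      Φ : ℕ → ℚ
      Φ m = t (k ∷ ks) (suc m) ℚ.+ 1/suc m ℚ.* V (suc d) (suc m)

      Φ-antitone : ∀ {m n} → m ℕ.≤′ n → Φ n ℚ.≤ Φ m
      Φ-antitone ℕ.≤′-refl = ℚ.≤-refl
      Φ-antitone (ℕ.≤′-step {m} m≤n) = ℚ.≤-trans (begin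
        t (k ∷ ks) (suc (suc m)) ℚ.+ z ℚ.* (V (suc d) (suc m) ℚ.+ z ℚ.* V d (suc m))
          ≤⟨ ℚ.+-monoˡ-≤ _ (t-step k ks (suc m)) ⟩
        p ℚ.+ 1/pow (suc m) k ℚ.* q ℚ.+ z ℚ.* (b ℚ.+ z ℚ.* c)
          ≤⟨ ℚ.+-monoˡ-≤ _ (ℚ.+-monoʳ-≤ p
               (ℚ.*-monoʳ-≤-nonNeg q {{ℚ.nonNegative (t-nonNeg ks (suc m))}} (1/pow≤² (suc m) k 1<k))) ⟩
        p ℚ.+ z ℚ.* z ℚ.* q ℚ.+ z ℚ.* (b ℚ.+ z ℚ.* c)
          ≡⟨ solve 5 (λ p z q b c → p :+ z :* z :* q :+ z :* (b :+ z :* c)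
                        := p :+ (z :* b :+ z :* z :* (q :+ c))) refl p z q b c ⟩
        p ℚ.+ (z ℚ.* b ℚ.+ z ℚ.* z ℚ.* (q ℚ.+ c))
          ≤⟨ ℚ.+-monoʳ-≤ p (ℚ.+-monoʳ-≤ (z ℚ.* b) (ℚ.*-monoˡ-≤-nonNeg (z ℚ.* z)
               {{ℚ.nonNegative (*-nonNeg (0≤1/suc (suc m)) (0≤1/suc (suc m)))}} (t-bound ks≢0 (suc m)))) ⟩
        p ℚ.+ (z ℚ.* b ℚ.+ z ℚ.* z ℚ.* b)
          ≡⟨ cong (p ℚ.+_) (ℚ.*-distribʳ-+ b z (z ℚ.* z)) ⟨
        p ℚ.+ (z ℚ.+ z ℚ.* z) ℚ.* b
          ≤⟨ ℚ.+-monoʳ-≤ p (ℚ.*-monoʳ-≤-nonNeg b {{ℚ.nonNegative (0≤V (suc d) (suc m))}} (reciprocals m)) ⟩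
        p ℚ.+ 1/suc m ℚ.* b ∎) (Φ-antitone m≤n)
        where
        z = 1/suc (suc m)
        p = t (k ∷ ks) (suc m)
        q = t ks (suc m)
        b = V (suc d) (suc m)
        c = V d (suc m)

      tail : ∀ {m n} → m ℕ.≤ n →
             t (k ∷ ks) (suc n) ℚ.- t (k ∷ ks) (suc m) ℚ.≤ 1/suc m ℚ.* V (suc d) (suc m)
      tail {m} {n} m≤n = begin
        t (k ∷ ks) (suc n) ℚ.- p
          ≤⟨ ℚ.+-monoˡ-≤ (ℚ.- p) (grow (t (k ∷ ks) (suc n)) {1/suc n ℚ.* V (suc d) (suc n)}
               (*-nonNeg {1/suc n} {V (suc d) (suc n)} (0≤1/suc n) (0≤V (suc d) (suc n)))) ⟩
        Φ n ℚ.- p                   ≤⟨ ℚ.+-monoˡ-≤ (ℚ.- p) (Φ-antitone (ℕ.≤⇒≤′ m≤n)) ⟩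
        p ℚ.+ e ℚ.- p               ≡⟨ solve 2 (λ p e → p :+ e :- p := e) refl p e ⟩
        e ∎
        where
        p = t (k ∷ ks) (suc m)
        e = 1/suc m ℚ.* V (suc d) (suc m)

      module _ (ε : ℚ) (0<ε : 0ℚ ℚ.< ε) where
        instance
          ε>0 : ℚ.Positive ε
          ε>0 = ℚ.positive 0<ε
          ε≢0 : ℚ.NonZero ε
          ε≢0 = ℚ.pos⇒nonZero ε

        L J C : ℕ
        L = proj₁ (ceiling (ℚ.1/ ε))
        J = suc L
        C = proj₁ (V-sublinear (suc d) (J ℕ.+ J))

        1<Jε : 1ℚ ℚ.< nat J ℚ.* ε
        1<Jε = begin-strict
          1ℚ               ≡⟨ ℚ.*-inverseˡ ε ⟨
          ℚ.1/ ε ℚ.* ε     ≤⟨ ℚ.*-monoʳ-≤-nonNeg ε {{ℚ.pos⇒nonNeg ε}} (proj₂ (ceiling (ℚ.1/ ε))) ⟩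
          nat L ℚ.* ε      ≡⟨ ℚ.+-identityˡ _ ⟨
          0ℚ ℚ.+ nat L ℚ.* ε  <⟨ ℚ.+-monoˡ-< (nat L ℚ.* ε) 0<ε ⟩
          ε ℚ.+ nat L ℚ.* ε         ≡⟨ ℚ.+-comm ε _ ⟩
          nat L ℚ.* ε ℚ.+ ε         ≡⟨ cong (nat L ℚ.* ε ℚ.+_) (ℚ.*-identityˡ ε) ⟨
          nat L ℚ.* ε ℚ.+ 1ℚ ℚ.* ε  ≡⟨ ℚ.*-distribʳ-+ ε (nat L) 1ℚ ⟨
          (nat L ℚ.+ 1ℚ) ℚ.* ε      ≡⟨ cong (ℚ._* ε) (nat-suc L) ⟨
          nat J ℚ.* ε ∎

        small : ∀ m → C ℕ.≤ m → 1/suc m ℚ.* V (suc d) (suc m) ℚ.< ε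
        small m C≤m = ℚ.*-cancelˡ-<-nonNeg (nat J) {{ℚ.nonNegative (0≤nat J)}} (ℚ.≤-<-trans (begin
          nat J ℚ.* (1/suc m ℚ.* b)
            ≡⟨ solve 3 (λ j y b → j :* (y :* b) := y :* (j :* b)) refl (nat J) (1/suc m) b ⟩
          1/suc m ℚ.* (nat J ℚ.* b)
            ≤⟨ ratio≤1 J C m b (proj₂ (V-sublinear (suc d) (J ℕ.+ J)) (suc m)) (ℕ.m≤n⇒m≤1+n C≤m) ⟩
          1ℚ ∎) 1<Jε)
          where b = V (suc d) (suc m)

        close : ∀ m n → C ℕ.≤ m → m ℕ.≤ n → ∣ t (k ∷ ks) (suc n) ℚ.- t (k ∷ ks) (suc m) ∣ ℚ.< ε
        close m n C≤m m≤n = subst (ℚ._< ε)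
          (sym (ℚ.0≤p⇒∣p∣≡p (subst (ℚ._≤ t (k ∷ ks) (suc n) ℚ.- p) (ℚ.+-inverseʳ p)
            (ℚ.+-monoˡ-≤ (ℚ.- p) (t-mono k ks (ℕ.≤⇒≤′ (ℕ.s≤s m≤n)))))))
          (ℚ.≤-<-trans (tail m≤n) (small m C≤m))
          where p = t (k ∷ ks) (suc m)

        ∣-∣-swap : ∀ p q → ∣ p ℚ.- q ∣ ≡ ∣ q ℚ.- p ∣
        ∣-∣-swap p q = trans (cong ∣_∣ (solve 2 (λ p q → p :- q := :- (q :- p)) refl p q))
                            (ℚ.∣-p∣≡∣p∣ (q ℚ.- p))

        t-cauchy : ∃[ K ] ∀ m n → K ℕ.≤ m → K ℕ.≤ n → ∣ t (k ∷ ks) m ℚ.- t (k ∷ ks) n ∣ ℚ.< ε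
        t-cauchy = suc C , λ { (suc m) (suc n) (ℕ.s≤s C≤m) (ℕ.s≤s C≤n) → ordered m n C≤m C≤n }
          where
          ordered : ∀ m n → C ℕ.≤ m → C ℕ.≤ n → ∣ t (k ∷ ks) (suc m) ℚ.- t (k ∷ ks) (suc n) ∣ ℚ.< ε
          ordered m n C≤m C≤n with ℕ.≤-total m n
          ... | inj₁ m≤n = subst (ℚ._< ε) (∣-∣-swap (t (k ∷ ks) (suc n)) (t (k ∷ ks) (suc m))) (close m n C≤m m≤n)
          ... | inj₂ n≤m = close n m C≤n n≤m

abstract
  truncated-t-isCauchy : ∀ N a .{{_ : NonZero N}} {κ} → Admissible κ → IsCauchy (truncated-t N a κ)
  truncated-t-isCauchy N a {k ∷ ks} (1<k , ks≢0) = Convergence.t-cauchy N a 1<k ks≢0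

module _ (N a : ℕ) .{{_ : NonZero N}} where

  t : ∀ {κ} → Admissible κ → ℝ
  t {κ} adm = real (truncated-t N a κ) (truncated-t-isCauchy N a adm)

  tʳ : ∀ {κ} → Admissible κ → ℝ[r]
  tʳ {k ∷ ks} adm = Σℝ[r] (All.reduce
    (λ {p} adm-p → monomial 0ℝ (length (k ∷ ks) ∸ length p) (t adm-p))
    (merges-admissible adm))

  X₀ : (k n s : ℕ) → ℝ[r]
  X₀ k n s = Σℝ[r] (All.reduce (λ κ∈I₀ → tʳ (proj₁ κ∈I₀)) (I₀-sound k n s))

  -- The exponents i = k - n - s, j = n - s, l = 2s - 2 determine (k, n, s): the
  -- triples with k ≥ n + s and n ≥ s ≥ 1 correspond to all i, j and all even l.
  generatingSeries : ℝ[r]⟦u,v,w⟧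
  generatingSeries i j l = if does (2 ℕ.∣? l) then X₀ k n s else []
    where
    s = suc ⌊ l /2⌋
    n = j ℕ.+ s
    k = i ℕ.+ n ℕ.+ s

module Hypergeometric {c ℓ} (A : CommutativeRing c ℓ) where
  open CommutativeRing A
  open RawSemiringOps (RawRing.rawSemiring rawRing) using (_^_) renaming (_×_ to _·_)

  infix 8 _⟨_⟩
  _⟨_⟩ : Carrier → ℕ → Carrier
  b ⟨ zero ⟩  = 1#
  b ⟨ suc n ⟩ = b ⟨ n ⟩ * (b + n · 1#)

  -- Numerator and denominator of the n-th term of ₃F₂(b₁,b₂,b₃; c₁,c₂; z)
  numerator : (b₁ b₂ b₃ z : Carrier) → ℕ → Carrier
  numerator b₁ b₂ b₃ z n = b₁ ⟨ n ⟩ * b₂ ⟨ n ⟩ * b₃ ⟨ n ⟩ * z ^ n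

  denominator : (c₁ c₂ : Carrier) → ℕ → Carrier
  denominator c₁ c₂ n = c₁ ⟨ n ⟩ * c₂ ⟨ n ⟩ * (n !) · 1#

-- A commutative ring containing ℚ[r]⟦u,v,w⟧ and elements α₁, α₂, β₁, β₂ with
-- the prescribed sums and products; such a ring exists, since both pairs are the
-- roots of monic quadratic polynomials over ℚ[r]⟦u,v,w⟧.
record Parameters c ℓ : Set (Level.suc (c Level.⊔ ℓ)) where
  field
    extension : CommutativeRing c ℓ

  open CommutativeRing extension public

  field
    ι                  : Series → Carrier
    isRingMonomorphism : IsRingMonomorphism ℚ[r]⟦u,v,w⟧ rawRing ι
    α₁ α₂ β₁ β₂        : Carrier
    α-sum              : α₁ + α₂ ≈ ι u + ι v * ι r
    α-product          : α₁ * α₂ ≈ ι r * (ι u * ι v - ι w * ι w)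
    β-sum              : β₁ + β₂ ≈ - ι u + ι v * (1# - ι r)
    β-product          : β₁ * β₂ ≈ (ι r - 1#) * (ι u * ι v - ι w * ι w)

-- τ is the expansion in ℚ[r]⟦u,v,w⟧ of the n-th term of
--   1/((a - α₁)(a - α₂)) · ₃F₂((a+β₁)/N, (a+β₂)/N, 1; (a-α₁)/N + 1, (a-α₂)/N + 1; 1).
-- Since (a - α₁)(a - α₂) · (c₁)ₙ (c₂)ₙ · n! is the image of a series with nonzero
-- rational constant term, hence of a unit, the equation determines τ.
IsTerm : ∀ {c ℓ} (N a : ℕ) .{{_ : NonZero N}} → Parameters c ℓ → ℕ → Series → Set ℓ
IsTerm N a P n τ =
  ι τ * ((a′ - α₁) * (a′ - α₂) * denominator c₁ c₂ n) ≈ numerator b₁ b₂ 1# 1# n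
  where
  open Parameters P
  open Hypergeometric extension
  open RawSemiringOps (RawRing.rawSemiring rawRing) using () renaming (_×_ to _·_)
  a′ 1/N b₁ b₂ c₁ c₂ : Carrier
  a′  = a · 1#
  1/N = ι (fromℚ (+ 1 / N))
  b₁  = (a′ + β₁) * 1/N
  b₂  = (a′ + β₂) * 1/N
  c₁  = (a′ - α₁) * 1/N + 1#
  c₂  = (a′ - α₂) * 1/N + 1#

{-# OPTIONS --safe #-}

-- Write m₀ < m₁ < ⋯ for the positive integers congruent to a modulo N.  Merging
-- two entries of an index amounts to letting two summation variables coincide, so
-- tʳ is a sum over weakly decreasing variables in which each equality counts r.
-- In the generating series each entry with variable m contributes
-- A = v/m + w²/(m(m - u)), the first one 1/(m(m - u)) if the index is admissible,
-- and a block of entries sharing the variable m sums to a geometric series in rA.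
-- As 1 - rA = (m - α₁)(m - α₂)/(m(m - u)), a first block gives
-- 1/((m - α₁)(m - α₂)) and an optional later one gives
-- 1 + A/(1 - rA) = (m + β₁)(m + β₂)/((m - α₁)(m - α₂)).  Hence the indices with
-- largest variable mₙ sum to the n-th term of the hypergeometric series, and the
-- partial sums of that series are exactly the truncated generating series.

module Submission where

open import Algebra.Bundles using (RawRing; CommutativeRing)
open import Algebra.Definitions using (LeftIdentity; LeftZero)
import Algebra.Definitions.RawSemiring as RawSemiringOps
open import Algebra.Morphism.Structures using (IsRingMonomorphism)
import Algebra.Properties.CommutativeSemigroup as CommutativeSemigroupProperties
import Algebra.Properties.Group as GroupProperties
import Algebra.Properties.Monoid.Mult as MonoidMult
import Algebra.Properties.Ring as RingProperties
import Algebra.Properties.Semiring.Exp as Exp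
import Algebra.Properties.Semiring.Mult as SemiringMult
import Algebra.Solver.Ring.NaturalCoefficients.Default as NaturalSolver
open import Algebra.Structures using (IsUnitalMagma)
open import Data.Bool.Base using (if_then_else_)
open import Data.Empty using (⊥-elim)
open import Data.Fin.Base using (Fin; zero; suc; toℕ)
open import Data.Integer.Base as ℤ using (+_)
import Data.Integer.Properties as ℤ
open import Data.List.Base as List using (List; []; _∷_; _++_; [_]; length; upTo)
open import Data.List.Membership.Propositional using (_∈_)
import Data.List.Membership.Propositional.Properties as Mem
open import Data.List.Membership.Propositional.Properties.WithK using (unique∧set⇒bag)
import Data.List.Properties as List
open import Data.List.Relation.Binary.BagAndSetEquality using (∼bag⇒↭)
open import Data.List.Relation.Binary.Permutation.Propositional using (_↭_; ↭⇒↭ₛ)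
import Data.List.Relation.Binary.Permutation.Propositional.Properties as ↭
import Data.List.Relation.Binary.Permutation.Setoid.Properties as ↭ₛ
open import Data.List.Relation.Unary.All as All using (All; []; _∷_)
import Data.List.Relation.Unary.All.Properties as All
open import Data.List.Relation.Unary.Any using (here; there)
open import Data.List.Relation.Unary.Unique.Propositional using (Unique; []; _∷_)
import Data.List.Relation.Unary.Unique.Propositional.Properties as Unique
open import Data.Nat.Base as ℕ
  using (ℕ; zero; suc; NonZero; _∸_; _≤_; _<_; z≤n; s≤s; _!; ⌊_/2⌋)
import Data.Nat.DivMod as ℕ
import Data.Nat.Divisibility as ℕ
import Data.Nat.Properties as ℕ
open import Data.Nat.Tactic.RingSolver using (solve-∀)
open import Data.Product.Base using (∃-syntax; _×_; _,_; proj₁; proj₂)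
open import Data.Rational.Base as ℚ using (ℚ; 0ℚ; 1ℚ; _/_)
import Data.Rational.Properties as ℚ
import Data.Rational.Unnormalised.Base as ℚᵘ
import Data.Rational.Unnormalised.Properties as ℚᵘ
open import Data.Sum.Base using (inj₁; inj₂)
open import Defs
open import Function.Base using (_∘_)
open import Function.Bundles using (mk⇔)
open import Level using (0ℓ)
open import Relation.Binary.Definitions using (tri<; tri≈; tri>)
open import Relation.Binary.PropositionalEquality as ≡
  using (_≡_; _≢_; refl; sym; trans; cong; cong₂; subst; module ≡-Reasoning)
import Relation.Binary.Reasoning.Setoid as SetoidReasoning
open import Relation.Nullary.Decidable using (Dec; yes; no; dec-true; dec-false)
open import Relation.Nullary.Negation using (¬_; contradiction)

open CommutativeSemigroupProperties (CommutativeRing.+-commutativeSemigroup ℚ.+-*-commutativeRing)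
  using (interchange)
open Exp (CommutativeRing.semiring ℚ.+-*-commutativeRing) using (_^_; ^-homo-*)
open SemiringMult (CommutativeRing.semiring ℚ.+-*-commutativeRing) using () renaming (_×_ to _·ℚ_)

-- Coefficient arithmetic in polynomials in r and series in u, v, w

coeff-add : ∀ p q d → coeff 0ℚ (addCoeffs ℚ._+_ p q) d ≡ coeff 0ℚ p d ℚ.+ coeff 0ℚ q d
coeff-add []      q       d       = sym (ℚ.+-identityˡ _)
coeff-add (x ∷ p) []      d       = sym (ℚ.+-identityʳ _)
coeff-add (x ∷ p) (y ∷ q) zero    = refl
coeff-add (x ∷ p) (y ∷ q) (suc d) = coeff-add p q d

infixr 7 _⋆_
_⋆_ : ℚ → List ℚ → List ℚ
c ⋆ p = List.map (c ℚ.*_) p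

coeff-⋆ : ∀ c p d → coeff 0ℚ (c ⋆ p) d ≡ c ℚ.* coeff 0ℚ p d
coeff-⋆ c []      d       = sym (ℚ.*-zeroʳ c)
coeff-⋆ c (x ∷ p) zero    = refl
coeff-⋆ c (x ∷ p) (suc d) = coeff-⋆ c p d

module ℚr = RawRing ℚ[r]

coeff-0∷[] : ∀ d → coeff 0ℚ (0ℚ ∷ []) d ≡ 0ℚ
coeff-0∷[] zero    = refl
coeff-0∷[] (suc d) = refl

[_]* : ∀ c p → [ c ] ℚr.* p ℚr.≈ c ⋆ p
[ c ]* p d = trans (coeff-add (c ⋆ p) (0ℚ ∷ []) d)
  (trans (cong (coeff 0ℚ (c ⋆ p) d ℚ.+_) (coeff-0∷[] d)) (ℚ.+-identityʳ _))

rℚ* : ∀ p → (0ℚ ∷ 1ℚ ∷ []) ℚr.* p ℚr.≈ 0ℚ ∷ p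
rℚ* p d = trans (coeff-add (0ℚ ⋆ p) (0ℚ ∷ [ 1ℚ ] ℚr.* p) d) (trans
  (cong (ℚ._+ coeff 0ℚ (0ℚ ∷ [ 1ℚ ] ℚr.* p) d) (trans (coeff-⋆ 0ℚ p d) (ℚ.*-zeroˡ (coeff 0ℚ p d))))
  (trans (ℚ.+-identityˡ _) (lemma d)))
  where
  lemma : 0ℚ ∷ [ 1ℚ ] ℚr.* p ℚr.≈ 0ℚ ∷ p
  lemma zero    = refl
  lemma (suc d) = trans ([ 1ℚ ]* p d) (trans (coeff-⋆ 1ℚ p d) (ℚ.*-identityˡ _))

-- The laws needed to multiply a series by a constant or a variable; all other ring
-- laws are inherited along the embedding ι.
record IsUnital (R : RawRing 0ℓ 0ℓ) : Set where
  open RawRing R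
  field
    +-isUnitalMagma : IsUnitalMagma _≈_ _+_ 0#
    *-zeroˡ         : LeftZero _≈_ 0# _*_
    *-identityˡ     : LeftIdentity _≈_ 1# _*_
  open IsUnitalMagma +-isUnitalMagma public
    renaming (∙-cong to +-cong; identityˡ to +-identityˡ; identityʳ to +-identityʳ)

ℚ[r]-isUnital : IsUnital ℚ[r]
ℚ[r]-isUnital = record
  { +-isUnitalMagma = record
    { isMagma = record
      { isEquivalence = record
        { refl  = λ d → refl
        ; sym   = λ p≈q d → sym (p≈q d)
        ; trans = λ p≈q q≈s d → trans (p≈q d) (q≈s d)
        }
      ; ∙-cong = λ {p} {p′} {q} {q′} p≈p′ q≈q′ d → trans (coeff-add p q d)
          (trans (cong₂ ℚ._+_ (p≈p′ d) (q≈q′ d)) (sym (coeff-add p′ q′ d)))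
      }
    ; identity = (λ p d → refl) , λ p d → trans (coeff-add p [] d) (ℚ.+-identityʳ _)
    }
  ; *-zeroˡ     = λ p d → refl
  ; *-identityˡ = λ p d → trans ([ 1ℚ ]* p d) (trans (coeff-⋆ 1ℚ p d) (ℚ.*-identityˡ _))
  }

-- The series ring is a power series ring in w, then v, then u. Working over an arbitrary unital
-- coefficient ring lets the same facts be instantiated once for each variable, as `W`, `V` and `U`.
module UnitalSeries {R : RawRing 0ℓ 0ℓ} (R-isUnital : IsUnital R) where
  open RawRing R
  open IsUnital R-isUnital renaming (refl to ≈-refl; sym to ≈-sym; trans to ≈-trans)
  open RawSemiringOps rawSemiring using (sum)
  open PowerSeries R public
  module S = RawRing series

  sum-zero : ∀ n (f : Fin n → Carrier) → (∀ i → f i ≈ 0#) → sum f ≈ 0#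
  sum-zero zero    f f≈0 = ≈-refl
  sum-zero (suc n) f f≈0 =
    ≈-trans (+-cong (f≈0 zero) (sum-zero n (λ i → f (suc i)) (λ i → f≈0 (suc i)))) (+-identityˡ 0#)

  constant-* : ∀ c f n → (constant c S.* f) n ≈ c * f n
  constant-* c f n = ≈-trans
    (+-cong ≈-refl (sum-zero n _ (λ i → *-zeroˡ (f (n ∸ suc (toℕ i))))))
    (+-identityʳ (c * f n))

  X-*-zero : ∀ f → (X S.* f) zero ≈ 0#
  X-*-zero f = ≈-trans (+-cong (*-zeroˡ (f 0)) ≈-refl) (+-identityˡ 0#)

  X-*-suc : ∀ f n → (X S.* f) (suc n) ≈ f n
  X-*-suc f n = ≈-trans
    (+-cong (*-zeroˡ (f (suc n)))
      (≈-trans (+-cong (*-identityˡ (f n)) (sum-zero n _ (λ i → *-zeroˡ (f (suc n ∸ suc (suc (toℕ i)))))))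
        (+-identityʳ (f n))))
    (+-identityˡ (f n))

  series-isUnital : IsUnital series
  series-isUnital = record
    { +-isUnitalMagma = record
      { isMagma = record
        { isEquivalence = record
          { refl  = λ n → ≈-refl
          ; sym   = λ f≈g n → ≈-sym (f≈g n)
          ; trans = λ f≈g g≈h n → ≈-trans (f≈g n) (g≈h n)
          }
        ; ∙-cong = λ f≈f′ g≈g′ n → +-cong (f≈f′ n) (g≈g′ n)
        }
      ; identity = (λ f n → +-identityˡ (f n)) , (λ f n → +-identityʳ (f n))
      }
    ; *-zeroˡ     = λ f n → sum-zero (suc n) _ (λ i → *-zeroˡ (f (n ∸ toℕ i)))
    ; *-identityˡ = λ f n → ≈-trans (constant-* 1# f n) (*-identityˡ (f n))
    }

module W = UnitalSeries ℚ[r]-isUnital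
module V = UnitalSeries W.series-isUnital
module U = UnitalSeries V.series-isUnital

module 𝕊 = RawRing ℚ[r]⟦u,v,w⟧

infix 30 _⟪_,_,_,_⟫
_⟪_,_,_,_⟫ : Series → ℕ → ℕ → ℕ → ℕ → ℚ
f ⟪ i , j , l , d ⟫ = coeff 0ℚ (f i j l) d

+-coeff : ∀ f g i j l d → (f 𝕊.+ g) ⟪ i , j , l , d ⟫ ≡ f ⟪ i , j , l , d ⟫ ℚ.+ g ⟪ i , j , l , d ⟫
+-coeff f g i j l = coeff-add (f i j l) (g i j l)

u*-zero : ∀ f j l d → (u 𝕊.* f) ⟪ 0 , j , l , d ⟫ ≡ 0ℚ
u*-zero f = U.X-*-zero f

u*-suc : ∀ f i j l d → (u 𝕊.* f) ⟪ suc i , j , l , d ⟫ ≡ f ⟪ i , j , l , d ⟫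
u*-suc f = U.X-*-suc f

v*-zero : ∀ f i l d → (v 𝕊.* f) ⟪ i , 0 , l , d ⟫ ≡ 0ℚ
v*-zero f i l d = trans (U.constant-* V.X f i 0 l d) (V.X-*-zero (f i) l d)

v*-suc : ∀ f i j l d → (v 𝕊.* f) ⟪ i , suc j , l , d ⟫ ≡ f ⟪ i , j , l , d ⟫
v*-suc f i j l d = trans (U.constant-* V.X f i (suc j) l d) (V.X-*-suc (f i) j l d)

w*-zero : ∀ f i j d → (w 𝕊.* f) ⟪ i , j , 0 , d ⟫ ≡ 0ℚ
w*-zero f i j d = trans (U.constant-* (V.constant W.X) f i j 0 d)
  (trans (V.constant-* W.X (f i) j 0 d) (W.X-*-zero (f i j) d))

w*-suc : ∀ f i j l d → (w 𝕊.* f) ⟪ i , j , suc l , d ⟫ ≡ f ⟪ i , j , l , d ⟫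
w*-suc f i j l d = trans (U.constant-* (V.constant W.X) f i j (suc l) d)
  (trans (V.constant-* W.X (f i) j (suc l) d) (W.X-*-suc (f i j) l d))

fromℚ[r]-* : ∀ p f i j l d → (fromℚ[r] p 𝕊.* f) ⟪ i , j , l , d ⟫ ≡ coeff 0ℚ (p ℚr.* f i j l) d
fromℚ[r]-* p f i j l d = trans (U.constant-* (V.constant (W.constant p)) f i j l d)
  (trans (V.constant-* (W.constant p) (f i) j l d) (W.constant-* p (f i j) l d))

fromℚ-* : ∀ c f i j l d → (fromℚ c 𝕊.* f) ⟪ i , j , l , d ⟫ ≡ c ℚ.* f ⟪ i , j , l , d ⟫
fromℚ-* c f i j l d = trans (fromℚ[r]-* [ c ] f i j l d)
  (trans ([ c ]* (f i j l) d) (coeff-⋆ c (f i j l) d))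

r* : ∀ f i j l → (r 𝕊.* f) i j l ℚr.≈ 0ℚ ∷ f i j l
r* f i j l d = trans (fromℚ[r]-* (0ℚ ∷ 1ℚ ∷ []) f i j l d) (rℚ* (f i j l) d)

-- Finite sums over lists

Σℚ : ∀ {A : Set} → (A → ℚ) → List A → ℚ
Σℚ f xs = List.foldr ℚ._+_ 0ℚ (List.map f xs)

Σℚ-++ : ∀ {A : Set} (f : A → ℚ) xs ys → Σℚ f (xs ++ ys) ≡ Σℚ f xs ℚ.+ Σℚ f ys
Σℚ-++ f []       ys = sym (ℚ.+-identityˡ (Σℚ f ys))
Σℚ-++ f (x ∷ xs) ys = trans (cong (f x ℚ.+_) (Σℚ-++ f xs ys))
  (sym (ℚ.+-assoc (f x) (Σℚ f xs) (Σℚ f ys)))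

Σℚ-map : ∀ {A B : Set} (f : B → ℚ) (g : A → B) xs → Σℚ f (List.map g xs) ≡ Σℚ (λ x → f (g x)) xs
Σℚ-map f g []       = refl
Σℚ-map f g (x ∷ xs) = cong (f (g x) ℚ.+_) (Σℚ-map f g xs)

Σℚ-cong : ∀ {A : Set} {f g : A → ℚ} → (∀ x → f x ≡ g x) → ∀ xs → Σℚ f xs ≡ Σℚ g xs
Σℚ-cong f≗g []       = refl
Σℚ-cong f≗g (x ∷ xs) = cong₂ ℚ._+_ (f≗g x) (Σℚ-cong f≗g xs)

Σℚ-zero : ∀ {A : Set} (xs : List A) → Σℚ (λ _ → 0ℚ) xs ≡ 0ℚ
Σℚ-zero []       = refl
Σℚ-zero (x ∷ xs) = trans (ℚ.+-identityˡ _) (Σℚ-zero xs)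

Σℚ-+ : ∀ {A : Set} (f g : A → ℚ) xs → Σℚ (λ x → f x ℚ.+ g x) xs ≡ Σℚ f xs ℚ.+ Σℚ g xs
Σℚ-+ f g []       = refl
Σℚ-+ f g (x ∷ xs) = trans (cong (f x ℚ.+ g x ℚ.+_) (Σℚ-+ f g xs))
  (interchange (f x) (g x) (Σℚ f xs) (Σℚ g xs))

Σℚ-* : ∀ {A : Set} c (f : A → ℚ) xs → Σℚ (λ x → c ℚ.* f x) xs ≡ c ℚ.* Σℚ f xs
Σℚ-* c f []       = sym (ℚ.*-zeroʳ c)
Σℚ-* c f (x ∷ xs) = trans (cong (c ℚ.* f x ℚ.+_) (Σℚ-* c f xs))
  (sym (ℚ.*-distribˡ-+ c (f x) (Σℚ f xs)))

Σℚ[r] : ∀ {A : Set} → (A → List ℚ) → List A → List ℚ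
Σℚ[r] f xs = List.foldr ℚr._+_ [] (List.map f xs)

coeff-Σ : ∀ {A : Set} (f : A → List ℚ) xs d → coeff 0ℚ (Σℚ[r] f xs) d ≡ Σℚ (λ x → coeff 0ℚ (f x) d) xs
coeff-Σ f []       d = refl
coeff-Σ f (x ∷ xs) d = trans (coeff-add (f x) (Σℚ[r] f xs) d)
  (cong (coeff 0ℚ (f x) d ℚ.+_) (coeff-Σ f xs d))

-- Prefixing `0ℚ` is multiplication by r, so this is its linearity; in degree zero every summand
-- vanishes.
coeff-0∷Σ : ∀ {A : Set} (f : A → List ℚ) xs d →
            coeff 0ℚ (0ℚ ∷ Σℚ[r] f xs) d ≡ Σℚ (λ x → coeff 0ℚ (0ℚ ∷ f x) d) xs
coeff-0∷Σ f xs zero    = sym (Σℚ-zero xs)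
coeff-0∷Σ f xs (suc d) = coeff-Σ f xs d

-- Enumeration of the indices belonging to a monomial

prepend : ℕ × List ℕ → List ℕ
prepend (k , ks) = k ∷ ks

-- Admissible indices are kept as pairs of head and tail so that raising the head is total and
-- injective.
increment : ℕ × List ℕ → ℕ × List ℕ
increment (k , ks) = suc k , ks

-- An index κ has the monomial u^i v^j w^l, where i sums k - 2 over the entries
-- k ≥ 2, j counts the entries 1, and l is twice the height.  An admissible index
-- is given by its head and tail, and its head k contributes u^(k-2) only.
indices     : ℕ → ℕ → ℕ → List (List ℕ)
ones        : ℕ → ℕ → ℕ → List (List ℕ)
bigs        : ℕ → ℕ → ℕ → List (List ℕ)
admissibles : ℕ → ℕ → ℕ → List (ℕ × List ℕ)
incremented : ℕ → ℕ → ℕ → List (ℕ × List ℕ)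
empties     : ℕ → ℕ → ℕ → List (List ℕ)

indices i j l = ones i j l ++ bigs i j l ++ empties i j l

ones i zero    l = []
ones i (suc j) l = List.map (1 ∷_) (indices i j l)

bigs i j zero          = []
bigs i j (suc zero)    = []
bigs i j (suc (suc l)) = List.map prepend (admissibles i j l)

admissibles i j l = List.map (2 ,_) (indices i j l) ++ incremented i j l

incremented zero    j l = []
incremented (suc i) j l = List.map increment (admissibles i j l)

empties zero zero zero = [ [] ]
empties i    j    l    = []

-- Truncated generating series and their linear relations

module Generating (x : ℕ → ℚ) where

  -- Let x n = 1/mₙ with m₀ < m₁ < ⋯.  As polynomials in r, t< n κ is tʳ(κ)
  -- truncated to variables below mₙ, and t= n κ is the part of tʳ(κ) in which the
  -- largest variable equals mₙ.
  t< t= : ℕ → List ℕ → List ℚ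
  t< zero    []       = [ 1ℚ ]
  t< zero    (k ∷ ks) = []
  t< (suc n) κ        = t< n κ ℚr.+ t= n κ
  t= n []       = []
  t= n (k ∷ ks) = (x n ^ k) ⋆ (t< n ks ℚr.+ (0ℚ ∷ t= n ks))

  -- `D` and `E` collect all indices, with variables below mₙ and with largest variable mₙ. `F` puts
  -- a 1 in front without charging its v, and `T` charges an admissible head k only u^(k-2). Thus v
  -- F and w² T are the parts of `E` whose first entry is 1 or larger, and `T n` is the candidate
  -- for the n-th hypergeometric term.
  D E F T : ℕ → Series
  D n i j l = Σℚ[r] (t< n) (indices i j l)
  E n i j l = Σℚ[r] (t= n) (indices i j l)
  F n i j l = Σℚ[r] (λ κ → t= n (1 ∷ κ)) (indices i j l)
  T n i j l = Σℚ[r] (λ κ → t= n (prepend κ)) (admissibles i j l)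

  coeff-t= : ∀ n k ks d → coeff 0ℚ (t= n (k ∷ ks)) d ≡
             x n ^ k ℚ.* (coeff 0ℚ (t< n ks) d ℚ.+ coeff 0ℚ (0ℚ ∷ t= n ks) d)
  coeff-t= n k ks d = trans (coeff-⋆ (x n ^ k) (t< n ks ℚr.+ (0ℚ ∷ t= n ks)) d)
    (cong (x n ^ k ℚ.*_) (coeff-add (t< n ks) (0ℚ ∷ t= n ks) d))

  t=-suc : ∀ n k ks d → coeff 0ℚ (t= n (suc k ∷ ks)) d ≡ x n ℚ.* coeff 0ℚ (t= n (k ∷ ks)) d
  t=-suc n k ks d = trans (coeff-t= n (suc k) ks d)
    (trans (ℚ.*-assoc (x n) (x n ^ k) y) (cong (x n ℚ.*_) (sym (coeff-t= n k ks d))))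
    where y = coeff 0ℚ (t< n ks) d ℚ.+ coeff 0ℚ (0ℚ ∷ t= n ks) d

  -- No variable lies below m₀, so only the empty index survives, and its monomial is 1.
  D-zero : D 0 𝕊.≈ 𝕊.1#
  D-zero i j l d = trans (coeff-Σ (t< 0) (indices i j l) d)
    (trans (Σℚ-++ f (ones i j l) (bigs i j l ++ empties i j l))
    (trans (cong₂ ℚ._+_ (ones≡0 i j l) (trans (Σℚ-++ f (bigs i j l) (empties i j l))
      (cong (ℚ._+ Σℚ f (empties i j l)) (bigs≡0 i j l))))
    (trans (trans (ℚ.+-identityˡ _) (ℚ.+-identityˡ _)) (empties≡ i j l))))
    where
    f : List ℕ → ℚ
    f κ = coeff 0ℚ (t< 0 κ) d

    ones≡0 : ∀ i j l → Σℚ f (ones i j l) ≡ 0ℚ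
    ones≡0 i zero    l = refl
    ones≡0 i (suc j) l = trans (Σℚ-map f (1 ∷_) (indices i j l)) (Σℚ-zero (indices i j l))

    bigs≡0 : ∀ i j l → Σℚ f (bigs i j l) ≡ 0ℚ
    bigs≡0 i j zero          = refl
    bigs≡0 i j (suc zero)    = refl
    bigs≡0 i j (suc (suc l)) = trans (Σℚ-map f prepend (admissibles i j l)) (Σℚ-zero (admissibles i j l))

    empties≡ : ∀ i j l → Σℚ f (empties i j l) ≡ 𝕊.1# ⟪ i , j , l , d ⟫
    empties≡ zero    zero    zero    = ℚ.+-identityʳ _
    empties≡ zero    zero    (suc l) = refl
    empties≡ zero    (suc j) l       = refl
    empties≡ (suc i) j       l       = refl

  D-suc : ∀ n → D (suc n) 𝕊.≈ D n 𝕊.+ E n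
  D-suc n i j l d = begin
    D (suc n) ⟪ i , j , l , d ⟫
      ≡⟨ coeff-Σ (t< (suc n)) κs d ⟩
    Σℚ (λ κ → coeff 0ℚ (t< n κ ℚr.+ t= n κ) d) κs
      ≡⟨ Σℚ-cong (λ κ → coeff-add (t< n κ) (t= n κ) d) κs ⟩
    Σℚ (λ κ → coeff 0ℚ (t< n κ) d ℚ.+ coeff 0ℚ (t= n κ) d) κs
      ≡⟨ Σℚ-+ (λ κ → coeff 0ℚ (t< n κ) d) (λ κ → coeff 0ℚ (t= n κ) d) κs ⟩
    Σℚ (λ κ → coeff 0ℚ (t< n κ) d) κs ℚ.+ Σℚ (λ κ → coeff 0ℚ (t= n κ) d) κs
      ≡⟨ cong₂ ℚ._+_ (coeff-Σ (t< n) κs d) (coeff-Σ (t= n) κs d) ⟨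
    D n ⟪ i , j , l , d ⟫ ℚ.+ E n ⟪ i , j , l , d ⟫
      ≡⟨ +-coeff (D n) (E n) i j l d ⟨
    (D n 𝕊.+ E n) ⟪ i , j , l , d ⟫ ∎
    where
    open ≡-Reasoning
    κs = indices i j l

  -- Behind a leading 1 with variable mₙ, the tail either has all its variables below mₙ, which
  -- gives `D n`, or starts at mₙ again, which gives `E n` with a factor r for the equality.
  F-relation : ∀ n → F n 𝕊.≈ fromℚ (x n) 𝕊.* (D n 𝕊.+ r 𝕊.* E n)
  F-relation n i j l d = begin
    F n ⟪ i , j , l , d ⟫
      ≡⟨ coeff-Σ (λ κ → t= n (1 ∷ κ)) κs d ⟩
    Σℚ (λ κ → coeff 0ℚ (t= n (1 ∷ κ)) d) κs
      ≡⟨ Σℚ-cong (λ κ → trans (coeff-t= n 1 κ d) (cong (ℚ._* (f κ ℚ.+ g κ)) (ℚ.*-identityʳ (x n)))) κs ⟩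
    Σℚ (λ κ → x n ℚ.* (f κ ℚ.+ g κ)) κs
      ≡⟨ Σℚ-* (x n) (λ κ → f κ ℚ.+ g κ) κs ⟩
    x n ℚ.* Σℚ (λ κ → f κ ℚ.+ g κ) κs
      ≡⟨ cong (x n ℚ.*_) (Σℚ-+ f g κs) ⟩
    x n ℚ.* (Σℚ f κs ℚ.+ Σℚ g κs)
      ≡⟨ cong (x n ℚ.*_) (cong₂ ℚ._+_ (coeff-Σ (t< n) κs d) (coeff-0∷Σ (t= n) κs d)) ⟨
    x n ℚ.* (D n ⟪ i , j , l , d ⟫ ℚ.+ coeff 0ℚ (0ℚ ∷ E n i j l) d)
      ≡⟨ cong (λ q → x n ℚ.* (D n ⟪ i , j , l , d ⟫ ℚ.+ q)) (r* (E n) i j l d) ⟨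
    x n ℚ.* (D n ⟪ i , j , l , d ⟫ ℚ.+ (r 𝕊.* E n) ⟪ i , j , l , d ⟫)
      ≡⟨ cong (x n ℚ.*_) (+-coeff (D n) (r 𝕊.* E n) i j l d) ⟨
    x n ℚ.* (D n 𝕊.+ r 𝕊.* E n) ⟪ i , j , l , d ⟫
      ≡⟨ fromℚ-* (x n) (D n 𝕊.+ r 𝕊.* E n) i j l d ⟨
    (fromℚ (x n) 𝕊.* (D n 𝕊.+ r 𝕊.* E n)) ⟪ i , j , l , d ⟫ ∎
    where
    open ≡-Reasoning
    κs = indices i j l
    f g : List ℕ → ℚ
    f κ = coeff 0ℚ (t< n κ) d
    g κ = coeff 0ℚ (0ℚ ∷ t= n κ) d

  -- A head 2 is a leading 1 with one more factor 1/mₙ. Any larger head arises by an increment,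
  -- which costs another 1/mₙ and earns a u. This encodes the geometric series T = F/(mₙ - u).
  T-relation : ∀ n → T n 𝕊.≈ fromℚ (x n) 𝕊.* (F n 𝕊.+ u 𝕊.* T n)
  T-relation n i j l d = begin
    T n ⟪ i , j , l , d ⟫
      ≡⟨ coeff-Σ (λ κ → t= n (prepend κ)) (admissibles i j l) d ⟩
    Σℚ f (admissibles i j l)
      ≡⟨ Σℚ-++ f (List.map (2 ,_) (indices i j l)) (incremented i j l) ⟩
    Σℚ f (List.map (2 ,_) (indices i j l)) ℚ.+ Σℚ f (incremented i j l)
      ≡⟨ cong₂ ℚ._+_ twos (incs i) ⟩
    x n ℚ.* F n ⟪ i , j , l , d ⟫ ℚ.+ x n ℚ.* (u 𝕊.* T n) ⟪ i , j , l , d ⟫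
      ≡⟨ ℚ.*-distribˡ-+ (x n) (F n ⟪ i , j , l , d ⟫) ((u 𝕊.* T n) ⟪ i , j , l , d ⟫) ⟨
    x n ℚ.* (F n ⟪ i , j , l , d ⟫ ℚ.+ (u 𝕊.* T n) ⟪ i , j , l , d ⟫)
      ≡⟨ cong (x n ℚ.*_) (+-coeff (F n) (u 𝕊.* T n) i j l d) ⟨
    x n ℚ.* (F n 𝕊.+ u 𝕊.* T n) ⟪ i , j , l , d ⟫
      ≡⟨ fromℚ-* (x n) (F n 𝕊.+ u 𝕊.* T n) i j l d ⟨
    (fromℚ (x n) 𝕊.* (F n 𝕊.+ u 𝕊.* T n)) ⟪ i , j , l , d ⟫ ∎
    where
    open ≡-Reasoning
    f : ℕ × List ℕ → ℚ
    f κ = coeff 0ℚ (t= n (prepend κ)) d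

    twos : Σℚ f (List.map (2 ,_) (indices i j l)) ≡ x n ℚ.* F n ⟪ i , j , l , d ⟫
    twos = trans (Σℚ-map f (2 ,_) (indices i j l))
      (trans (Σℚ-cong (λ κ → t=-suc n 1 κ d) (indices i j l))
      (trans (Σℚ-* (x n) (λ κ → coeff 0ℚ (t= n (1 ∷ κ)) d) (indices i j l))
      (cong (x n ℚ.*_) (sym (coeff-Σ (λ κ → t= n (1 ∷ κ)) (indices i j l) d)))))

    incs : ∀ i → Σℚ f (incremented i j l) ≡ x n ℚ.* (u 𝕊.* T n) ⟪ i , j , l , d ⟫
    incs zero    = sym (trans (cong (x n ℚ.*_) (u*-zero (T n) j l d)) (ℚ.*-zeroʳ (x n)))
    incs (suc i) = trans (Σℚ-map f increment (admissibles i j l))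
      (trans (Σℚ-cong (λ { (k , ks) → t=-suc n k ks d }) (admissibles i j l))
      (trans (Σℚ-* (x n) f (admissibles i j l))
      (cong (x n ℚ.*_) (trans (sym (coeff-Σ (λ κ → t= n (prepend κ)) (admissibles i j l) d))
        (sym (u*-suc (T n) i j l d))))))

  -- The indices split by their first entry: a 1 is worth v, a larger entry is worth the w² that `T`
  -- leaves out, and the empty index has no largest variable and contributes 0.
  E-relation : ∀ n → E n 𝕊.≈ v 𝕊.* F n 𝕊.+ w 𝕊.* (w 𝕊.* T n)
  E-relation n i j l d = begin
    E n ⟪ i , j , l , d ⟫
      ≡⟨ coeff-Σ (t= n) (indices i j l) d ⟩
    Σℚ f (indices i j l)
      ≡⟨ Σℚ-++ f (ones i j l) (bigs i j l ++ empties i j l) ⟩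
    Σℚ f (ones i j l) ℚ.+ Σℚ f (bigs i j l ++ empties i j l)
      ≡⟨ cong (Σℚ f (ones i j l) ℚ.+_) (Σℚ-++ f (bigs i j l) (empties i j l)) ⟩
    Σℚ f (ones i j l) ℚ.+ (Σℚ f (bigs i j l) ℚ.+ Σℚ f (empties i j l))
      ≡⟨ cong₂ ℚ._+_ (ones≡ j) (trans (cong (Σℚ f (bigs i j l) ℚ.+_) (empties≡0 i j l))
           (trans (ℚ.+-identityʳ (Σℚ f (bigs i j l))) (bigs≡ l))) ⟩
    (v 𝕊.* F n) ⟪ i , j , l , d ⟫ ℚ.+ (w 𝕊.* (w 𝕊.* T n)) ⟪ i , j , l , d ⟫
      ≡⟨ +-coeff (v 𝕊.* F n) (w 𝕊.* (w 𝕊.* T n)) i j l d ⟨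
    (v 𝕊.* F n 𝕊.+ w 𝕊.* (w 𝕊.* T n)) ⟪ i , j , l , d ⟫ ∎
    where
    open ≡-Reasoning
    f : List ℕ → ℚ
    f κ = coeff 0ℚ (t= n κ) d

    ones≡ : ∀ j → Σℚ f (ones i j l) ≡ (v 𝕊.* F n) ⟪ i , j , l , d ⟫
    ones≡ zero    = sym (v*-zero (F n) i l d)
    ones≡ (suc j) = trans (Σℚ-map f (1 ∷_) (indices i j l))
      (trans (sym (coeff-Σ (λ κ → t= n (1 ∷ κ)) (indices i j l) d)) (sym (v*-suc (F n) i j l d)))

    bigs≡ : ∀ l → Σℚ f (bigs i j l) ≡ (w 𝕊.* (w 𝕊.* T n)) ⟪ i , j , l , d ⟫
    bigs≡ zero          = sym (w*-zero (w 𝕊.* T n) i j d)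
    bigs≡ (suc zero)    = sym (trans (w*-suc (w 𝕊.* T n) i j 0 d) (w*-zero (T n) i j d))
    bigs≡ (suc (suc l)) = trans (Σℚ-map f prepend (admissibles i j l))
      (trans (sym (coeff-Σ (λ κ → t= n (prepend κ)) (admissibles i j l) d))
      (sym (trans (w*-suc (w 𝕊.* T n) i j (suc l) d) (w*-suc (T n) i j l d))))

    empties≡0 : ∀ i j l → Σℚ f (empties i j l) ≡ 0ℚ
    empties≡0 zero    zero    zero    = refl
    empties≡0 zero    zero    (suc l) = refl
    empties≡0 zero    (suc j) l       = refl
    empties≡0 (suc i) j       l       = refl

-- Reciprocals of the progression and constant series

1/n+k/n : ∀ k n .{{_ : NonZero n}} → + 1 / n ℚ.+ + k / n ≡ + suc k / n
1/n+k/n k n@(suc m) = ℚ.toℚᵘ-injective (ℚᵘ.≃-trans (ℚ.toℚᵘ-homo-+ (+ 1 / n) (+ k / n))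
  (ℚᵘ.≃-trans (ℚᵘ.+-cong (ℚ.toℚᵘ-fromℚᵘ (ℚᵘ.mkℚᵘ (+ 1) m)) (ℚ.toℚᵘ-fromℚᵘ (ℚᵘ.mkℚᵘ (+ k) m)))
  (ℚᵘ.≃-trans (ℚᵘ.*≡* lemma) (ℚᵘ.≃-sym (ℚ.toℚᵘ-fromℚᵘ (ℚᵘ.mkℚᵘ (+ suc k) m))))))
  where
  lemma : (+ 1 ℤ.* + n ℤ.+ + k ℤ.* + n) ℤ.* + n ≡ + suc k ℤ.* (+ n ℤ.* + n)
  lemma = trans (cong (ℤ._* + n) (sym (ℤ.*-distribʳ-+ (+ n) (+ 1) (+ k))))
    (ℤ.*-assoc (+ suc k) (+ n) (+ n))

k·1/n : ∀ k n .{{_ : NonZero n}} → k ·ℚ (+ 1 / n) ≡ + k / n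
k·1/n zero    n = sym (ℚ.0/n≡0 n)
k·1/n (suc k) n = trans (cong (+ 1 / n ℚ.+_) (k·1/n k n)) (1/n+k/n k n)

-- Phrased with repeated addition because the integers of the extension ring are multiples of its
-- unit.
n·1/n : ∀ n .{{_ : NonZero n}} → n ·ℚ (+ 1 / n) ≡ 1ℚ
n·1/n n@(suc m) = trans (k·1/n n n) (ℚ.toℚᵘ-injective
  (ℚᵘ.≃-trans (ℚ.toℚᵘ-fromℚᵘ (ℚᵘ.mkℚᵘ (+ n) m)) (ℚᵘ.*≡* (ℤ.*-comm (+ n) (+ 1)))))

progression-nonZero : ∀ N a .{{_ : NonZero a}} n → NonZero (a ℕ.+ n ℕ.* N)
progression-nonZero N a n = ℕ.≢-nonZero (λ eq → ℕ.≢-nonZero⁻¹ a (ℕ.m+n≡0⇒m≡0 a eq))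

reciprocal : ∀ N a .{{_ : NonZero a}} → ℕ → ℚ
reciprocal N a n = (+ 1 / (a ℕ.+ n ℕ.* N)) {{progression-nonZero N a n}}

fromℚ-0 : fromℚ 0ℚ 𝕊.≈ 𝕊.0#
fromℚ-0 zero    zero    zero    d = coeff-0∷[] d
fromℚ-0 zero    zero    (suc l) d = refl
fromℚ-0 zero    (suc j) l       d = refl
fromℚ-0 (suc i) j       l       d = refl

fromℚ-+ : ∀ p q → fromℚ (p ℚ.+ q) 𝕊.≈ fromℚ p 𝕊.+ fromℚ q
fromℚ-+ p q zero    zero    zero    d = refl
fromℚ-+ p q zero    zero    (suc l) d = refl
fromℚ-+ p q zero    (suc j) l       d = refl
fromℚ-+ p q (suc i) j       l       d = refl

-- Elimination of E and F from the linear relations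

module Elimination {c ℓ} (A : CommutativeRing c ℓ) where
  open CommutativeRing A renaming (refl to ≈-refl; sym to ≈-sym; trans to ≈-trans)
  open GroupProperties +-group using () renaming (∙-cancelʳ to +-cancelʳ)
  open NaturalSolver commutativeSemiring
  open SetoidReasoning setoid

  module _ {m u v w r D E F T p₁ p₂ : Carrier}
    (mF≈D+rE : m * F ≈ D + r * E) (mT≈F+uT : m * T ≈ F + u * T)
    (E≈vF+w²T : E ≈ v * F + w * (w * T))
    (p-sum : p₁ + p₂ + (u + v * r) ≈ 0#)
    (p-product : p₁ * p₂ + r * (w * w) ≈ r * (u * v)) where

    P : Carrier
    P = (m + p₁) * (m + p₂)

    -- As F = (m - u)T, the series E is (v(m - u) + w²)T. The negative term stands on the left
    -- because the solver works in semirings.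
    E+uvT : E + u * v * T ≈ v * (m * T) + w * (w * T)
    E+uvT = begin
      E + u * v * T                        ≈⟨ +-congʳ E≈vF+w²T ⟩
      v * F + w * (w * T) + u * v * T
        ≈⟨ solve 5 (λ u v w F T → v :* F :+ w :* (w :* T) :+ u :* v :* T
                      := v :* (F :+ u :* T) :+ w :* (w :* T)) ≈-refl u v w F T ⟩
      v * (F + u * T) + w * (w * T)        ≈⟨ +-congʳ (*-congˡ mT≈F+uT) ⟨
      v * (m * T) + w * (w * T) ∎

    -- Subtraction-free form of m(m - u)T = mF = D + rE.
    m²T : m * (m * T) ≈ D + r * E + u * (m * T)
    m²T = begin
      m * (m * T)              ≈⟨ *-congˡ mT≈F+uT ⟩
      m * (F + u * T)          ≈⟨ solve 4 (λ m u F T → m :* (F :+ u :* T) := m :* F :+ u :* (m :* T)) ≈-refl m u F T ⟩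
      m * F + u * (m * T)      ≈⟨ +-congʳ mF≈D+rE ⟩
      D + r * E + u * (m * T) ∎

    -- With p₁ = -α₁ and p₂ = -α₂.  Adding Z on both sides removes all
    -- subtractions, so that the steps are semiring identities.
    TP≈D : T * P ≈ D
    TP≈D = +-cancelʳ Z (T * P) D (begin
      T * P + Z
        ≈⟨ solve 8 (λ m u v w r T p q → T :* ((m :+ p) :* (m :+ q)) :+ (m :* T :* (u :+ v :* r) :+ r :* (w :* w) :* T)
              := m :* (m :* T) :+ m :* T :* (p :+ q :+ (u :+ v :* r)) :+ T :* (p :* q :+ r :* (w :* w)))
             ≈-refl m u v w r T p₁ p₂ ⟩
      m * (m * T) + m * T * (p₁ + p₂ + (u + v * r)) + T * (p₁ * p₂ + r * (w * w))
        ≈⟨ +-cong (+-cong m²T (*-congˡ p-sum)) (*-congˡ p-product) ⟩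
      D + r * E + u * (m * T) + m * T * 0# + T * (r * (u * v))
        ≈⟨ solve 7 (λ m u v r D E T → D :+ r :* E :+ u :* (m :* T) :+ m :* T :* con 0 :+ T :* (r :* (u :* v))
              := D :+ (r :* (E :+ u :* v :* T) :+ u :* (m :* T))) ≈-refl m u v r D E T ⟩
      D + (r * (E + u * v * T) + u * (m * T))
        ≈⟨ +-congˡ (+-congʳ (*-congˡ E+uvT)) ⟩
      D + (r * (v * (m * T) + w * (w * T)) + u * (m * T))
        ≈⟨ solve 7 (λ m u v w r D T → D :+ (r :* (v :* (m :* T) :+ w :* (w :* T)) :+ u :* (m :* T))
              := D :+ (m :* T :* (u :+ v :* r) :+ r :* (w :* w) :* T)) ≈-refl m u v w r D T ⟩
      D + Z ∎)
      where Z = m * T * (u + v * r) + r * (w * w) * T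

    module _ {D′ β₁ β₂ : Carrier} (D′≈D+E : D′ ≈ D + E)
      (β-sum : β₁ + β₂ + (u + v * r) ≈ v)
      (β-product : β₁ * β₂ + (r * (w * w) + u * v) ≈ r * (u * v) + w * w) where

      Q : Carrier
      Q = (m + β₁) * (m + β₂)

      -- The sum of the β exceeds that of the p by v, and β₁β₂ is smaller than p₁p₂ by uv - w².
      -- Hence Q - P = v(m - u) + w², the factor that relates E to T. Adding `Z` brings the sums and
      -- products of the roots into the form in which they are given.
      Q+uv : Q + u * v ≈ P + (m * v + w * w)
      Q+uv = +-cancelʳ Z (Q + u * v) (P + (m * v + w * w)) (begin
        Q + u * v + Z
          ≈⟨ solve 7 (λ m u v w r b c → (m :+ b) :* (m :+ c) :+ u :* v :+ (m :* (u :+ v :* r) :+ r :* (w :* w))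
                := m :* m :+ m :* (b :+ c :+ (u :+ v :* r)) :+ (b :* c :+ (r :* (w :* w) :+ u :* v)))
               ≈-refl m u v w r β₁ β₂ ⟩
        m * m + m * (β₁ + β₂ + (u + v * r)) + (β₁ * β₂ + (r * (w * w) + u * v))
          ≈⟨ +-cong (+-congˡ (*-congˡ β-sum)) β-product ⟩
        m * m + m * v + (r * (u * v) + w * w)
          ≈⟨ solve 5 (λ m u v w r → m :* m :+ m :* v :+ (r :* (u :* v) :+ w :* w)
                := m :* m :+ m :* con 0 :+ r :* (u :* v) :+ (m :* v :+ w :* w)) ≈-refl m u v w r ⟩
        m * m + m * 0# + r * (u * v) + (m * v + w * w)
          ≈⟨ +-congʳ (+-cong (+-congˡ (*-congˡ p-sum)) p-product) ⟨
        m * m + m * (p₁ + p₂ + (u + v * r)) + (p₁ * p₂ + r * (w * w)) + (m * v + w * w)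
          ≈⟨ solve 7 (λ m u v w r p q → m :* m :+ m :* (p :+ q :+ (u :+ v :* r)) :+ (p :* q :+ r :* (w :* w)) :+ (m :* v :+ w :* w)
                := (m :+ p) :* (m :+ q) :+ (m :* v :+ w :* w) :+ (m :* (u :+ v :* r) :+ r :* (w :* w)))
               ≈-refl m u v w r p₁ p₂ ⟩
        P + (m * v + w * w) + Z ∎)
        where Z = m * (u + v * r) + r * (w * w)

      -- Since E = (Q - P)T and TP = D, the product EP is (Q - P)D, so (D + E)P = DQ. This is the
      -- factor 1 + A/(1 - rA) = Q/P of an optional block, cleared of denominators.
      D′P≈DQ : D′ * P ≈ D * Q
      D′P≈DQ = +-cancelʳ (D * (u * v)) (D′ * P) (D * Q) (begin
        -- Only the `D` of the auxiliary summand is replaced by `T * P`; the summand then completes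
        -- `E` to the left side of `E+uvT`.
        D′ * P + D * (u * v)                ≈⟨ +-cong (*-congʳ D′≈D+E) (*-congʳ (≈-sym TP≈D)) ⟩
        (D + E) * P + T * P * (u * v)
          ≈⟨ solve 6 (λ u v D E T P → (D :+ E) :* P :+ T :* P :* (u :* v)
                := D :* P :+ (E :+ u :* v :* T) :* P) ≈-refl u v D E T P ⟩
        D * P + (E + u * v * T) * P         ≈⟨ +-congˡ (*-congʳ E+uvT) ⟩
        D * P + (v * (m * T) + w * (w * T)) * P
          ≈⟨ solve 6 (λ m v w D T P → D :* P :+ (v :* (m :* T) :+ w :* (w :* T)) :* P
                := D :* P :+ (T :* P) :* (m :* v :+ w :* w)) ≈-refl m v w D T P ⟩
        D * P + (T * P) * (m * v + w * w)   ≈⟨ +-congˡ (*-congʳ TP≈D) ⟩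
        D * P + D * (m * v + w * w)         ≈⟨ distribˡ D P (m * v + w * w) ⟨
        D * (P + (m * v + w * w))           ≈⟨ *-congˡ Q+uv ⟨
        D * (Q + u * v)                     ≈⟨ distribˡ D Q (u * v) ⟩
        D * Q + D * (u * v) ∎)

-- The hypergeometric terms in the extension ring

module Terms {c ℓ} (N a : ℕ) .{{_ : NonZero N}} (P : Parameters c ℓ) where
  open Parameters P renaming (refl to ≈-refl; sym to ≈-sym; trans to ≈-trans)
  open IsRingMonomorphism isRingMonomorphism
    using (+-homo; *-homo; 0#-homo; 1#-homo) renaming (⟦⟧-cong to ι-cong)
  open RawSemiringOps (RawRing.rawSemiring rawRing) using () renaming (_×_ to _·_; _^_ to _^ᴬ_)
  open SemiringMult semiring using (×1-homo-*)
  open MonoidMult +-monoid using (×-homo-+)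
  open Hypergeometric extension
  open NaturalSolver commutativeSemiring using (solve; _:+_; _:*_; _:=_; con)
  open RingProperties ring using (-‿distribʳ-*; -‿distribˡ-*; -‿involutive; -‿+-comm)
  open SetoidReasoning setoid

  ·-fromℚ : ∀ k q → k · 1# * ι (fromℚ q) ≈ ι (fromℚ (k ·ℚ q))
  ·-fromℚ zero    q = ≈-trans (zeroˡ _) (≈-sym (≈-trans (ι-cong fromℚ-0) 0#-homo))
  ·-fromℚ (suc k) q = begin
    (1# + k · 1#) * ι (fromℚ q)               ≈⟨ distribʳ _ 1# (k · 1#) ⟩
    1# * ι (fromℚ q) + k · 1# * ι (fromℚ q)   ≈⟨ +-cong (*-identityˡ _) (·-fromℚ k q) ⟩
    ι (fromℚ q) + ι (fromℚ (k ·ℚ q))          ≈⟨ +-homo (fromℚ q) (fromℚ (k ·ℚ q)) ⟨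
    ι (fromℚ q 𝕊.+ fromℚ (k ·ℚ q))            ≈⟨ ι-cong (fromℚ-+ q (k ·ℚ q)) ⟨
    ι (fromℚ (suc k ·ℚ q)) ∎

  ·-inverse : ∀ n .{{_ : NonZero n}} → n · 1# * ι (fromℚ (+ 1 / n)) ≈ 1#
  ·-inverse n = ≈-trans (·-fromℚ n (+ 1 / n))
    (≈-trans (reflexive (cong (λ q → ι (fromℚ q)) (n·1/n n))) 1#-homo)

  a′ N′ y uv ww : Carrier
  a′ = a · 1#
  N′ = N · 1#
  y  = ι (fromℚ (+ 1 / N))
  uv = ι u * ι v
  ww = ι w * ι w

  neg-uv+ww : - (uv + - ww) + uv ≈ ww
  neg-uv+ww = begin
    - (uv + - ww) + uv      ≈⟨ +-congʳ (-‿+-comm uv (- ww)) ⟨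
    - uv + - (- ww) + uv    ≈⟨ +-congʳ (+-congˡ (-‿involutive ww)) ⟩
    - uv + ww + uv          ≈⟨ solve 3 (λ n x z → n :+ z :+ x := n :+ x :+ z) ≈-refl (- uv) uv ww ⟩
    - uv + uv + ww          ≈⟨ +-congʳ (-‿inverseˡ uv) ⟩
    0# + ww                 ≈⟨ +-identityˡ ww ⟩
    ww ∎

  uv-ww+ww : uv + - ww + ww ≈ uv
  uv-ww+ww = ≈-trans (+-assoc uv (- ww) ww) (≈-trans (+-congˡ (-‿inverseˡ ww)) (+-identityʳ uv))

  -- This and the next three lemmas bring the equations for α and β into the subtraction-free form
  -- that the elimination takes as hypotheses.
  p-sum : - α₁ + - α₂ + (ι u + ι v * ι r) ≈ 0#
  p-sum = begin
    - α₁ + - α₂ + (ι u + ι v * ι r)    ≈⟨ +-cong (-‿+-comm α₁ α₂) (≈-sym α-sum) ⟩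
    - (α₁ + α₂) + (α₁ + α₂)            ≈⟨ -‿inverseˡ (α₁ + α₂) ⟩
    0# ∎

  p-product : - α₁ * - α₂ + ι r * ww ≈ ι r * uv
  p-product = begin
    - α₁ * - α₂ + ι r * ww             ≈⟨ +-congʳ (-‿distribˡ-* α₁ (- α₂)) ⟨
    - (α₁ * - α₂) + ι r * ww           ≈⟨ +-congʳ (-‿cong (-‿distribʳ-* α₁ α₂)) ⟨
    - (- (α₁ * α₂)) + ι r * ww         ≈⟨ +-congʳ (-‿involutive (α₁ * α₂)) ⟩
    α₁ * α₂ + ι r * ww                 ≈⟨ +-congʳ α-product ⟩
    ι r * (uv + - ww) + ι r * ww       ≈⟨ distribˡ (ι r) (uv + - ww) ww ⟨
    ι r * (uv + - ww + ww)             ≈⟨ *-congˡ uv-ww+ww ⟩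
    ι r * uv ∎

  β-sum′ : β₁ + β₂ + (ι u + ι v * ι r) ≈ ι v
  β-sum′ = begin
    β₁ + β₂ + (ι u + ι v * ι r)                            ≈⟨ +-congʳ β-sum ⟩
    - ι u + ι v * (1# + - ι r) + (ι u + ι v * ι r)
      ≈⟨ solve 5 (λ n u v s r → n :+ v :* (con 1 :+ s) :+ (u :+ v :* r)
            := n :+ u :+ v :* (con 1 :+ (s :+ r))) ≈-refl (- ι u) (ι u) (ι v) (- ι r) (ι r) ⟩
    - ι u + ι u + ι v * (1# + (- ι r + ι r))
      ≈⟨ +-cong (-‿inverseˡ (ι u)) (*-congˡ (+-congˡ (-‿inverseˡ (ι r)))) ⟩
    0# + ι v * (1# + 0#)    ≈⟨ solve 1 (λ v → con 0 :+ v :* (con 1 :+ con 0) := v) ≈-refl (ι v) ⟩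
    ι v ∎

  β-product′ : β₁ * β₂ + (ι r * ww + uv) ≈ ι r * uv + ww
  β-product′ = begin
    β₁ * β₂ + (ι r * ww + uv)                   ≈⟨ +-congʳ β-product ⟩
    (ι r + - 1#) * z + (ι r * ww + uv)          ≈⟨ +-congʳ (distribʳ z (ι r) (- 1#)) ⟩
    ι r * z + - 1# * z + (ι r * ww + uv)
      ≈⟨ +-congʳ (+-congˡ (≈-trans (≈-sym (-‿distribˡ-* 1# z)) (-‿cong (*-identityˡ z)))) ⟩
    ι r * z + - z + (ι r * ww + uv)
      ≈⟨ solve 5 (λ r z n w x → r :* z :+ n :+ (r :* w :+ x) := r :* (z :+ w) :+ (n :+ x)) ≈-refl (ι r) z (- z) ww uv ⟩
    ι r * (z + ww) + (- z + uv)                 ≈⟨ +-cong (*-congˡ uv-ww+ww) neg-uv+ww ⟩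
    ι r * uv + ww ∎
    where z = uv + - ww

  M : ℕ → Carrier
  M n = a′ + n · 1# * N′

  ·-progression : ∀ n → (a ℕ.+ n ℕ.* N) · 1# ≈ M n
  ·-progression n = ≈-trans (×-homo-+ 1# a (n ℕ.* N)) (+-congˡ (×1-homo-* n N))

  module _ .{{_ : NonZero a}} where

    private
      x : ℕ → ℚ
      x = reciprocal N a

    open Generating x

    Mx≈1 : ∀ n → M n * ι (fromℚ (x n)) ≈ 1#
    Mx≈1 n = ≈-trans (*-congʳ (≈-sym (·-progression n)))
      (·-inverse (a ℕ.+ n ℕ.* N) {{progression-nonZero N a n}})

    -- `M n` is the inverse of the constant 1/mₙ in the extension, so each relation with a factor
    -- 1/mₙ becomes a polynomial relation in mₙ.
    cancel-x : ∀ n {f g} → f 𝕊.≈ fromℚ (x n) 𝕊.* g → M n * ι f ≈ ι g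
    cancel-x n {f} {g} f≈xg = begin
      M n * ι f                          ≈⟨ *-congˡ (≈-trans (ι-cong f≈xg) (*-homo (fromℚ (x n)) g)) ⟩
      M n * (ι (fromℚ (x n)) * ι g)      ≈⟨ *-assoc (M n) (ι (fromℚ (x n))) (ι g) ⟨
      M n * ι (fromℚ (x n)) * ι g        ≈⟨ *-congʳ (Mx≈1 n) ⟩
      1# * ι g                           ≈⟨ *-identityˡ (ι g) ⟩
      ι g ∎

    mF : ∀ n → M n * ι (F n) ≈ ι (D n) + ι r * ι (E n)
    mF n = ≈-trans (cancel-x n (F-relation n))
      (≈-trans (+-homo (D n) (r 𝕊.* E n)) (+-congˡ (*-homo r (E n))))

    mT : ∀ n → M n * ι (T n) ≈ ι (F n) + ι u * ι (T n)
    mT n = ≈-trans (cancel-x n (T-relation n))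
      (≈-trans (+-homo (F n) (u 𝕊.* T n)) (+-congˡ (*-homo u (T n))))

    ιE : ∀ n → ι (E n) ≈ ι v * ι (F n) + ι w * (ι w * ι (T n))
    ιE n = ≈-trans (ι-cong (E-relation n)) (≈-trans (+-homo (v 𝕊.* F n) (w 𝕊.* (w 𝕊.* T n)))
      (+-cong (*-homo v (F n)) (≈-trans (*-homo w (w 𝕊.* T n)) (*-congˡ (*-homo w (T n))))))

    -- `R n` is P₀ ⋯ Pₙ₋₁ / N^(2n). Carrying it in both numerator and denominator avoids any
    -- division by the Pᵢ.
    Pₙ Qₙ R : ℕ → Carrier
    Pₙ n = (M n + - α₁) * (M n + - α₂)
    Qₙ n = (M n + β₁) * (M n + β₂)
    R zero    = 1#
    R (suc n) = y * y * (Pₙ n * R n)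

    TP : ∀ n → ι (T n) * Pₙ n ≈ ι (D n)
    TP n = Elimination.TP≈D extension (mF n) (mT n) (ιE n) p-sum p-product

    DP : ∀ n → ι (D (suc n)) * Pₙ n ≈ ι (D n) * Qₙ n
    DP n = Elimination.D′P≈DQ extension (mF n) (mT n) (ιE n) p-sum p-product
      (≈-trans (ι-cong (D-suc n)) (+-homo (D n) (E n))) β-sum′ β-product′

    N′y≈1 : N′ * y ≈ 1#
    N′y≈1 = ·-inverse N

    -- Since n = nN · (1/N), adding n to (a + β)/N moves a on to mₙ = a + nN.
    b-factor : ∀ β n → (a′ + β) * y + n · 1# ≈ (M n + β) * y
    b-factor β n = begin
      (a′ + β) * y + k              ≈⟨ +-congˡ (*-identityʳ k) ⟨
      (a′ + β) * y + k * 1#         ≈⟨ +-congˡ (*-congˡ N′y≈1) ⟨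
      (a′ + β) * y + k * (N′ * y)
        ≈⟨ solve 5 (λ a b y k N → (a :+ b) :* y :+ k :* (N :* y) := (a :+ k :* N :+ b) :* y) ≈-refl a′ β y k N′ ⟩
      (M n + β) * y ∎
      where k = n · 1#

    -- The summand 1 in the lower parameters puts them one step ahead: the factor at n belongs to
    -- mₙ₊₁, and m₀ is left to the prefactor.
    c-factor : ∀ α n → (a′ + α) * y + 1# + n · 1# ≈ (M (suc n) + α) * y
    c-factor α n = ≈-trans (+-assoc _ 1# (n · 1#)) (b-factor α (suc n))

    c₁ c₂ b₁ b₂ X : Carrier
    c₁ = (a′ + - α₁) * y + 1#
    c₂ = (a′ + - α₂) * y + 1#
    b₁ = (a′ + β₁) * y
    b₂ = (a′ + β₂) * y
    X  = (a′ + - α₁) * (a′ + - α₂)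

    -- The prefactor `X` is P₀, and the Pochhammer factors contribute P₁, ..., Pₙ, each divided by
    -- N².
    denominator≈ : ∀ n → X * (c₁ ⟨ n ⟩ * c₂ ⟨ n ⟩) ≈ Pₙ n * R n
    denominator≈ zero = solve 4 (λ a N p q → (a :+ p) :* (a :+ q) :* (con 1 :* con 1)
      := (a :+ con 0 :* N :+ p) :* (a :+ con 0 :* N :+ q) :* con 1) ≈-refl a′ N′ (- α₁) (- α₂)
    denominator≈ (suc n) = begin
      X * (c₁ ⟨ n ⟩ * (c₁ + n · 1#) * (c₂ ⟨ n ⟩ * (c₂ + n · 1#)))
        ≈⟨ solve 5 (λ X c d e f → X :* (c :* d :* (e :* f)) := X :* (c :* e) :* (d :* f)) ≈-refl
             X (c₁ ⟨ n ⟩) (c₁ + n · 1#) (c₂ ⟨ n ⟩) (c₂ + n · 1#) ⟩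
      X * (c₁ ⟨ n ⟩ * c₂ ⟨ n ⟩) * ((c₁ + n · 1#) * (c₂ + n · 1#))
        ≈⟨ *-cong (denominator≈ n) (*-cong (c-factor (- α₁) n) (c-factor (- α₂) n)) ⟩
      Pₙ n * R n * ((M (suc n) + - α₁) * y * ((M (suc n) + - α₂) * y))
        ≈⟨ solve 4 (λ p d e y → p :* (d :* y :* (e :* y)) := d :* e :* (y :* y :* p)) ≈-refl
             (Pₙ n * R n) (M (suc n) + - α₁) (M (suc n) + - α₂) y ⟩
      Pₙ (suc n) * R (suc n) ∎

    -- Each step multiplies by Qₙ/N², and `DP` trades `D n` times Qₙ for `D (suc n)` times Pₙ, which
    -- is absorbed into `R (suc n)`.
    numerator≈ : ∀ n → b₁ ⟨ n ⟩ * b₂ ⟨ n ⟩ ≈ ι (D n) * R n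
    numerator≈ zero    = *-congʳ (≈-sym (≈-trans (ι-cong D-zero) 1#-homo))
    numerator≈ (suc n) = begin
      b₁ ⟨ n ⟩ * (b₁ + n · 1#) * (b₂ ⟨ n ⟩ * (b₂ + n · 1#))
        ≈⟨ solve 4 (λ c d e f → c :* d :* (e :* f) := c :* e :* (d :* f)) ≈-refl
             (b₁ ⟨ n ⟩) (b₁ + n · 1#) (b₂ ⟨ n ⟩) (b₂ + n · 1#) ⟩
      b₁ ⟨ n ⟩ * b₂ ⟨ n ⟩ * ((b₁ + n · 1#) * (b₂ + n · 1#))
        ≈⟨ *-cong (numerator≈ n) (*-cong (b-factor β₁ n) (b-factor β₂ n)) ⟩
      ι (D n) * R n * ((M n + β₁) * y * ((M n + β₂) * y))
        ≈⟨ solve 5 (λ D R d e y → D :* R :* (d :* y :* (e :* y)) := D :* (d :* e) :* (y :* y :* R)) ≈-refl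
             (ι (D n)) (R n) (M n + β₁) (M n + β₂) y ⟩
      ι (D n) * Qₙ n * (y * y * R n)            ≈⟨ *-congʳ (DP n) ⟨
      ι (D (suc n)) * Pₙ n * (y * y * R n)
        ≈⟨ solve 4 (λ D P y R → D :* P :* (y :* y :* R) := D :* (y :* y :* (P :* R))) ≈-refl
             (ι (D (suc n))) (Pₙ n) y (R n) ⟩
      ι (D (suc n)) * R (suc n) ∎

    -- The upper parameter 1 thereby cancels the n! in the denominator of the series.
    1⟨⟩ : ∀ n → 1# ⟨ n ⟩ ≈ (n !) · 1#
    1⟨⟩ zero    = ≈-sym (+-identityʳ 1#)
    1⟨⟩ (suc n) = ≈-trans (*-congʳ (1⟨⟩ n)) (≈-trans (*-comm ((n !) · 1#) (suc n · 1#))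
      (≈-sym (×1-homo-* (suc n) (n !))))

    1^ : ∀ n → 1# ^ᴬ n ≈ 1#
    1^ zero    = ≈-refl
    1^ (suc n) = ≈-trans (*-identityˡ (1# ^ᴬ n)) (1^ n)

    -- Both sides become `D n` times `R n` times n!: the left one by `TP`, the right one by
    -- `numerator≈`.
    isTerm : ∀ n → IsTerm N a P n (T n)
    isTerm n = begin
      ι (T n) * (X * (c₁ ⟨ n ⟩ * c₂ ⟨ n ⟩ * k))
        ≈⟨ solve 5 (λ T X c d k → T :* (X :* (c :* d :* k)) := T :* (X :* (c :* d)) :* k) ≈-refl
             (ι (T n)) X (c₁ ⟨ n ⟩) (c₂ ⟨ n ⟩) k ⟩
      ι (T n) * (X * (c₁ ⟨ n ⟩ * c₂ ⟨ n ⟩)) * k    ≈⟨ *-congʳ (*-congˡ (denominator≈ n)) ⟩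
      ι (T n) * (Pₙ n * R n) * k                   ≈⟨ *-congʳ (*-assoc (ι (T n)) (Pₙ n) (R n)) ⟨
      ι (T n) * Pₙ n * R n * k                     ≈⟨ *-congʳ (*-congʳ (TP n)) ⟩
      ι (D n) * R n * k                            ≈⟨ *-congʳ (numerator≈ n) ⟨
      b₁ ⟨ n ⟩ * b₂ ⟨ n ⟩ * k                      ≈⟨ *-congˡ (1⟨⟩ n) ⟨
      b₁ ⟨ n ⟩ * b₂ ⟨ n ⟩ * 1# ⟨ n ⟩               ≈⟨ *-identityʳ _ ⟨
      b₁ ⟨ n ⟩ * b₂ ⟨ n ⟩ * 1# ⟨ n ⟩ * 1#          ≈⟨ *-congˡ (1^ n) ⟨
      b₁ ⟨ n ⟩ * b₂ ⟨ n ⟩ * 1# ⟨ n ⟩ * 1# ^ᴬ n ∎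
      where k = (n !) · 1#

-- Merging entries as equality of summation variables

-- merge f k ls d is the coefficient of r^d in the sum of r^(n - dep p) f(p) over
-- the indices p obtained from (k □ l₁ □ ⋯ □ lₙ₋₁) with ls = l₁, ..., lₙ₋₁.
merge : (List ℕ → ℚ) → ℕ → List ℕ → ℕ → ℚ
merge f k []       zero    = f [ k ]
merge f k []       (suc d) = 0ℚ
merge f k (l ∷ ls) zero    = merge (f ∘ (k ∷_)) l ls zero
merge f k (l ∷ ls) (suc d) = merge (f ∘ (k ∷_)) l ls (suc d) ℚ.+ merge f (k ℕ.+ l) ls d

-- Merging never produces the empty index, so agreement on nonempty lists is enough. This matters
-- for `nested` at 0, which vanishes only on nonempty lists.
merge-cong : ∀ {f g} → (∀ k ks → f (k ∷ ks) ≡ g (k ∷ ks)) → ∀ k ls d → merge f k ls d ≡ merge g k ls d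
merge-cong f≗g k []       zero    = f≗g k []
merge-cong f≗g k []       (suc d) = refl
merge-cong f≗g k (l ∷ ls) zero    = merge-cong (λ j js → f≗g k (j ∷ js)) l ls zero
merge-cong f≗g k (l ∷ ls) (suc d) = cong₂ ℚ._+_
  (merge-cong (λ j js → f≗g k (j ∷ js)) l ls (suc d)) (merge-cong f≗g (k ℕ.+ l) ls d)

merge-+ : ∀ f g k ls d → merge (λ p → f p ℚ.+ g p) k ls d ≡ merge f k ls d ℚ.+ merge g k ls d
merge-+ f g k []       zero    = refl
merge-+ f g k []       (suc d) = refl
merge-+ f g k (l ∷ ls) zero    = merge-+ (f ∘ (k ∷_)) (g ∘ (k ∷_)) l ls zero
merge-+ f g k (l ∷ ls) (suc d) = trans
  (cong₂ ℚ._+_ (merge-+ (f ∘ (k ∷_)) (g ∘ (k ∷_)) l ls (suc d)) (merge-+ f g (k ℕ.+ l) ls d))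
  (interchange (merge (f ∘ (k ∷_)) l ls (suc d)) (merge (g ∘ (k ∷_)) l ls (suc d))
    (merge f (k ℕ.+ l) ls d) (merge g (k ℕ.+ l) ls d))

merge-* : ∀ c f k ls d → merge (λ p → c ℚ.* f p) k ls d ≡ c ℚ.* merge f k ls d
merge-* c f k []       zero    = refl
merge-* c f k []       (suc d) = sym (ℚ.*-zeroʳ c)
merge-* c f k (l ∷ ls) zero    = merge-* c (f ∘ (k ∷_)) l ls zero
merge-* c f k (l ∷ ls) (suc d) = trans
  (cong₂ ℚ._+_ (merge-* c (f ∘ (k ∷_)) l ls (suc d)) (merge-* c f (k ℕ.+ l) ls d))
  (sym (ℚ.*-distribˡ-+ c (merge (f ∘ (k ∷_)) l ls (suc d)) (merge f (k ℕ.+ l) ls d)))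

merge-zero : ∀ {f} → (∀ k ks → f (k ∷ ks) ≡ 0ℚ) → ∀ k ls d → merge f k ls d ≡ 0ℚ
merge-zero {f} f≗0 k ls d =
  trans (merge-cong (λ j js → trans (f≗0 j js) (sym (ℚ.*-zeroˡ (f (j ∷ js))))) k ls d)
    (trans (merge-* 0ℚ f k ls d) (ℚ.*-zeroˡ (merge f k ls d)))

-- Adding k to the first entry before merging adds k to the head of every merged index, so one
-- factor c comes out of each term.
merge-shift : ∀ {f} k c → (∀ j js → f (k ℕ.+ j ∷ js) ≡ c ℚ.* f (j ∷ js)) →
              ∀ l ls d → merge f (k ℕ.+ l) ls d ≡ c ℚ.* merge f l ls d
merge-shift k c shift l []        zero    = shift l []
merge-shift k c shift l []        (suc d) = sym (ℚ.*-zeroʳ c)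
merge-shift {f} k c shift l (l′ ∷ ls) zero =
  trans (merge-cong (λ j js → shift l (j ∷ js)) l′ ls zero) (merge-* c (f ∘ (l ∷_)) l′ ls zero)
merge-shift {f} k c shift l (l′ ∷ ls) (suc d) = trans
  (cong₂ ℚ._+_
    (trans (merge-cong (λ j js → shift l (j ∷ js)) l′ ls (suc d)) (merge-* c (f ∘ (l ∷_)) l′ ls (suc d)))
    (trans (cong (λ e → merge f e ls d) (ℕ.+-assoc k l l′)) (merge-shift {f} k c shift (l ℕ.+ l′) ls d)))
  (sym (ℚ.*-distribˡ-+ c (merge (f ∘ (l ∷_)) l′ ls (suc d)) (merge f (l ℕ.+ l′) ls d)))

merges-length : ∀ k ls → All (λ p → length p ≤ suc (length ls)) (merges k ls)
merges-length k []       = s≤s z≤n ∷ []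
merges-length k (l ∷ ls) = All.++⁺ (All.map⁺ (All.map s≤s (merges-length l ls)))
  (All.map ℕ.m≤n⇒m≤1+n (merges-length (k ℕ.+ l) ls))

Σℚ-cong-All : ∀ {A : Set} {f g : A → ℚ} {xs} → All (λ x → f x ≡ g x) xs → Σℚ f xs ≡ Σℚ g xs
Σℚ-cong-All []          = refl
Σℚ-cong-All (eq ∷ eqs)  = cong₂ ℚ._+_ eq (Σℚ-cong-All eqs)

-- Split at the first box: a comma lengthens index and merged index alike and keeps the exponent of
-- r, while a plus sign raises the exponent by one.
merges-merge : ∀ f k ls d →
  Σℚ (λ p → coeff 0ℚ (monomial 0ℚ (suc (length ls) ∸ length p) (f p)) d) (merges k ls) ≡ merge f k ls d
merges-merge f k []       zero    = ℚ.+-identityʳ (f [ k ])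
merges-merge f k []       (suc d) = refl
merges-merge f k (l ∷ ls) d = trans (Σℚ-++ (g d) (List.map (k ∷_) (merges l ls)) (merges (k ℕ.+ l) ls))
  (trans (cong (ℚ._+ Σℚ (g d) (merges (k ℕ.+ l) ls))
    (trans (Σℚ-map (g d) (k ∷_) (merges l ls)) (merges-merge (f ∘ (k ∷_)) l ls d))) (lemma d))
  where
  g : ℕ → List ℕ → ℚ
  g d p = coeff 0ℚ (monomial 0ℚ (suc (suc (length ls)) ∸ length p) (f p)) d

  h : ℕ → List ℕ → ℚ
  h d p = coeff 0ℚ (0ℚ ∷ monomial 0ℚ (suc (length ls) ∸ length p) (f p)) d

  -- The depth bound is what lets the successor leave the truncated subtraction.
  g≗h : ∀ d → Σℚ (g d) (merges (k ℕ.+ l) ls) ≡ Σℚ (h d) (merges (k ℕ.+ l) ls)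
  g≗h d = Σℚ-cong-All (All.map
    (λ {p} p≤ → cong (λ e → coeff 0ℚ (monomial 0ℚ e (f p)) d) (ℕ.+-∸-assoc 1 p≤))
    (merges-length (k ℕ.+ l) ls))

  lemma : ∀ d → merge (f ∘ (k ∷_)) l ls d ℚ.+ Σℚ (g d) (merges (k ℕ.+ l) ls) ≡ merge f k (l ∷ ls) d
  lemma zero    = trans (cong (merge (f ∘ (k ∷_)) l ls zero ℚ.+_)
    (trans (g≗h zero) (Σℚ-zero (merges (k ℕ.+ l) ls)))) (ℚ.+-identityʳ _)
  lemma (suc d) = cong (merge (f ∘ (k ∷_)) l ls (suc d) ℚ.+_)
    (trans (g≗h (suc d)) (merges-merge f (k ℕ.+ l) ls d))

module _ (x : ℕ → ℚ) where
  open Generating x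

  -- `nested` and `top` are the counterparts of `t<` and `t=` with strictly decreasing variables and
  -- no r.
  nested : List ℕ → ℕ → ℚ
  nested []       n       = 1ℚ
  nested (k ∷ ks) zero    = 0ℚ
  nested (k ∷ ks) (suc n) = nested (k ∷ ks) n ℚ.+ x n ^ k ℚ.* nested ks n

  top : ℕ → List ℕ → ℚ
  top n []       = 0ℚ
  top n (k ∷ ks) = x n ^ k ℚ.* nested ks n

  t<-[] : ∀ n d → coeff 0ℚ (t< n []) d ≡ coeff 0ℚ [ 1ℚ ] d
  t<-[] zero    d = refl
  t<-[] (suc n) d = trans (coeff-add (t< n []) [] d) (trans (ℚ.+-identityʳ _) (t<-[] n d))

  -- A weakly decreasing chain of variables becomes strict once entries with equal variables are
  -- added up, and each such addition is one plus sign, hence one r. The proof is a joint induction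
  -- with `merge-top`, adding one variable at a time.
  merge-nested : ∀ n k ls d → merge (λ p → nested p n) k ls d ≡ coeff 0ℚ (t< n (k ∷ ls)) d
  merge-top    : ∀ n k ls d → merge (top n) k ls d ≡ coeff 0ℚ (t= n (k ∷ ls)) d

  merge-nested zero    k ls d = merge-zero (λ _ _ → refl) k ls d
  merge-nested (suc n) k ls d = trans (merge-cong (λ _ _ → refl) k ls d)
    (trans (merge-+ (λ p → nested p n) (top n) k ls d)
    (trans (cong₂ ℚ._+_ (merge-nested n k ls d) (merge-top n k ls d))
      (sym (coeff-add (t< n (k ∷ ls)) (t= n (k ∷ ls)) d))))

  merge-top n k ls d = trans (lemma ls d) (sym (coeff-t= n k ls d))
    where
    lemma : ∀ ls d → merge (top n) k ls d ≡
            x n ^ k ℚ.* (coeff 0ℚ (t< n ls) d ℚ.+ coeff 0ℚ (0ℚ ∷ t= n ls) d)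
    lemma [] zero = cong (x n ^ k ℚ.*_) (sym (trans (ℚ.+-identityʳ _) (t<-[] n 0)))
    lemma [] (suc d) = sym (trans (cong (x n ^ k ℚ.*_) (trans (ℚ.+-identityʳ _) (t<-[] n (suc d))))
      (ℚ.*-zeroʳ (x n ^ k)))
    lemma (l ∷ ls) zero = trans (merge-* (x n ^ k) (λ p → nested p n) l ls 0)
      (cong (x n ^ k ℚ.*_) (trans (merge-nested n l ls 0) (sym (ℚ.+-identityʳ _))))
    -- A comma keeps the later variables below mₙ. A plus sign gives l the variable mₙ too and uses
    -- up one power of r; `merge-shift` then extracts the factor belonging to k.
    lemma (l ∷ ls) (suc d) = trans (cong₂ ℚ._+_
      (trans (merge-* (x n ^ k) (λ p → nested p n) l ls (suc d))
        (cong (x n ^ k ℚ.*_) (merge-nested n l ls (suc d))))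
      (trans (merge-shift k (x n ^ k) shift l ls d) (cong (x n ^ k ℚ.*_) (merge-top n l ls d))))
      (sym (ℚ.*-distribˡ-+ (x n ^ k) (coeff 0ℚ (t< n (l ∷ ls)) (suc d)) (coeff 0ℚ (t= n (l ∷ ls)) d)))
      where
      shift : ∀ j js → top n (k ℕ.+ j ∷ js) ≡ x n ^ k ℚ.* top n (j ∷ js)
      shift j js = trans (cong (ℚ._* nested js n) (^-homo-* (x n) k j))
        (ℚ.*-assoc (x n ^ k) (x n ^ j) (nested js n))

-- Approximations of real polynomials

approx-add : ∀ p q d n → approx (coeff 0ℝ (p +ℝ[r] q) d) n ≡
             approx (coeff 0ℝ p d) n ℚ.+ approx (coeff 0ℝ q d) n
approx-add []      q       d       n = sym (ℚ.+-identityˡ _)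
approx-add (y ∷ p) []      d       n = sym (ℚ.+-identityʳ _)
approx-add (y ∷ p) (z ∷ q) zero    n = refl
approx-add (y ∷ p) (z ∷ q) (suc d) n = approx-add p q d n

approx-monomial : ∀ e y d n → approx (coeff 0ℝ (monomial 0ℝ e y) d) n ≡ coeff 0ℚ (monomial 0ℚ e (approx y n)) d
approx-monomial zero    y zero    n = refl
approx-monomial zero    y (suc d) n = refl
approx-monomial (suc e) y zero    n = refl
approx-monomial (suc e) y (suc d) n = approx-monomial e y d n

-- The real summands are built from proofs `px`, but their approximations depend on `x` alone, so
-- the sum descends to the bare list.
approx-Σ : ∀ {A : Set} {P : A → Set} (f : ∀ {x} → P x → ℝ[r]) (g : A → ℚ) d n →
           (∀ {x} (px : P x) → approx (coeff 0ℝ (f px) d) n ≡ g x) → ∀ {xs} (pxs : All P xs) →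
           approx (coeff 0ℝ (Σℝ[r] (All.reduce f pxs)) d) n ≡ Σℚ g xs
approx-Σ f g d n eq []         = refl
approx-Σ f g d n eq (px ∷ pxs) =
  trans (approx-add (f px) (Σℝ[r] (All.reduce f pxs)) d n) (cong₂ ℚ._+_ (eq px) (approx-Σ f g d n eq pxs))

-- Truncated sums along the residue class

1/mn : ∀ m n .{{_ : NonZero m}} .{{_ : NonZero n}} .{{_ : NonZero (m ℕ.* n)}} →
       + 1 / (m ℕ.* n) ≡ (+ 1 / m) ℚ.* (+ 1 / n)
1/mn m@(suc m-1) n@(suc n-1) = ℚ.toℚᵘ-injective
  (ℚᵘ.≃-trans (ℚ.toℚᵘ-fromℚᵘ (ℚᵘ.mkℚᵘ (+ 1) (ℕ.pred (m ℕ.* n))))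
  (ℚᵘ.≃-sym (ℚᵘ.≃-trans (ℚ.toℚᵘ-homo-* (+ 1 / m) (+ 1 / n))
    (ℚᵘ.≃-trans (ℚᵘ.*-cong (ℚ.toℚᵘ-fromℚᵘ (ℚᵘ.mkℚᵘ (+ 1) m-1)) (ℚ.toℚᵘ-fromℚᵘ (ℚᵘ.mkℚᵘ (+ 1) n-1)))
      (ℚᵘ.*≡* refl)))))

1/m^k : ∀ m k .{{_ : NonZero m}} → (+ 1 / (m ℕ.^ k)) {{ℕ.m^n≢0 m k}} ≡ (+ 1 / m) ^ k
1/m^k m zero    = refl
1/m^k m (suc k) {{m≢0}} = trans (1/mn m (m ℕ.^ k) {{m≢0}} {{ℕ.m^n≢0 m k}} {{ℕ.m^n≢0 m (suc k)}})
  (cong ((+ 1 / m) ℚ.*_) (1/m^k m k))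

-- The representatives run over 1, ..., N, so N itself has remainder 0 and is treated apart.
residue-injective : ∀ {i j N} .{{_ : NonZero N}} → 0 < i → 0 < j → i ≤ N → j ≤ N →
                    i ℕ.% N ≡ j ℕ.% N → i ≡ j
residue-injective {i} {j} {N} 0<i 0<j i≤N j≤N eq with ℕ.m≤n⇒m<n∨m≡n i≤N | ℕ.m≤n⇒m<n∨m≡n j≤N
... | inj₁ i<N  | inj₁ j<N  = trans (sym (ℕ.m<n⇒m%n≡m i<N)) (trans eq (ℕ.m<n⇒m%n≡m j<N))
... | inj₂ i≡N  | inj₂ j≡N  = trans i≡N (sym j≡N)
... | inj₁ i<N  | inj₂ refl = ⊥-elim (ℕ.<⇒≢ 0<i (sym (trans (sym (ℕ.m<n⇒m%n≡m i<N)) (trans eq (ℕ.n%n≡0 N)))))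
... | inj₂ refl | inj₁ j<N  = ⊥-elim (ℕ.<⇒≢ 0<j (trans (sym (ℕ.n%n≡0 N)) (trans eq (ℕ.m<n⇒m%n≡m j<N))))

module Progression (N a : ℕ) .{{_ : NonZero N}} .{{_ : NonZero a}} (a≤N : a ≤ N) where

  private
    x : ℕ → ℚ
    x = reciprocal N a

  0<a : 0 < a
  0<a = ℕ.>-nonZero⁻¹ a

  miss : ∀ k ks n j → j < N → suc j ≢ a →
    truncated-t N a (k ∷ ks) (suc j ℕ.+ n ℕ.* N) ≡ truncated-t N a (k ∷ ks) (j ℕ.+ n ℕ.* N)
  miss k ks n j j<N 1+j≢a = trans
    (cong (λ b → truncated-t N a (k ∷ ks) m ℚ.+
                 (if b then (+ 1 / (suc m ℕ.^ k)) {{ℕ.m^n≢0 (suc m) k}} ℚ.* truncated-t N a ks m else 0ℚ))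
      (dec-false (suc m ℕ.% N ℕ.≟ a ℕ.% N) λ eq → 1+j≢a
        (residue-injective (s≤s z≤n) 0<a j<N a≤N (trans (sym (ℕ.[m+kn]%n≡m%n (suc j) n N)) eq))))
    (ℚ.+-identityʳ _)
    where m = j ℕ.+ n ℕ.* N

  hit : ∀ k ks n j → suc j ≡ a → truncated-t N a (k ∷ ks) (suc j ℕ.+ n ℕ.* N) ≡
    truncated-t N a (k ∷ ks) (j ℕ.+ n ℕ.* N) ℚ.+ x n ^ k ℚ.* truncated-t N a ks (j ℕ.+ n ℕ.* N)
  hit k ks n j 1+j≡a = trans
    (cong (λ b → truncated-t N a (k ∷ ks) m ℚ.+
                 (if b then (+ 1 / (suc m ℕ.^ k)) {{ℕ.m^n≢0 (suc m) k}} ℚ.* truncated-t N a ks m else 0ℚ))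
      (dec-true (suc m ℕ.% N ℕ.≟ a ℕ.% N)
        (trans (ℕ.[m+kn]%n≡m%n (suc j) n N) (cong (ℕ._% N) 1+j≡a))))
    (cong (λ q → truncated-t N a (k ∷ ks) m ℚ.+ q ℚ.* truncated-t N a ks m)
      (trans (1/m^k (suc m) k) (cong (_^ k) (1/suc-m a 1+j≡a))))
    where
    m = j ℕ.+ n ℕ.* N
    1/suc-m : ∀ a .{{_ : NonZero a}} → suc j ≡ a → + 1 / suc m ≡ reciprocal N a n
    1/suc-m a refl = refl

  -- With j the position in the block from nN to (n + 1)N, the sum can change only when mₙ = a + nN
  -- is reached, that is at j = a.
  truncated-t-block : ∀ n κ j → j ≤ N →
    (j < a → truncated-t N a κ (j ℕ.+ n ℕ.* N) ≡ nested x κ n) ×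
    (a ≤ j → truncated-t N a κ (j ℕ.+ n ℕ.* N) ≡ nested x κ (suc n))
  truncated-t-block n       []       j    j≤N = (λ _ → refl) , (λ _ → refl)
  truncated-t-block zero    (k ∷ ks) zero j≤N = (λ _ → refl) , λ a≤0 → ⊥-elim (ℕ.<⇒≱ 0<a a≤0)
  -- The start of a block is the end of the previous one, whose jump has happened because a ≤ N.
  truncated-t-block (suc n) (k ∷ ks) zero j≤N =
    (λ _ → proj₂ (truncated-t-block n (k ∷ ks) N ℕ.≤-refl) a≤N) , λ a≤0 → ⊥-elim (ℕ.<⇒≱ 0<a a≤0)
  truncated-t-block n (k ∷ ks) (suc j) j<N with ℕ.<-cmp (suc j) a
  ... | tri< 1+j<a 1+j≢a _ =
    (λ _ → trans (miss k ks n j j<N 1+j≢a)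
      (proj₁ (truncated-t-block n (k ∷ ks) j (ℕ.<⇒≤ j<N)) (ℕ.<⇒≤ 1+j<a))) ,
    (λ a≤1+j → ⊥-elim (ℕ.<⇒≱ 1+j<a a≤1+j))
  ... | tri≈ _ 1+j≡a _ =
    (λ 1+j<a → ⊥-elim (ℕ.<⇒≢ 1+j<a 1+j≡a)) ,
    -- The tail is cut off at mₙ - 1, before the jump, so its variables stay strictly below mₙ.
    (λ _ → trans (hit k ks n j 1+j≡a) (cong₂ (λ p q → p ℚ.+ x n ^ k ℚ.* q)
      (proj₁ (truncated-t-block n (k ∷ ks) j (ℕ.<⇒≤ j<N)) (ℕ.≤-reflexive 1+j≡a))
      (proj₁ (truncated-t-block n ks j (ℕ.<⇒≤ j<N)) (ℕ.≤-reflexive 1+j≡a))))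
  ... | tri> _ 1+j≢a a<1+j =
    (λ 1+j<a → ⊥-elim (ℕ.<⇒≯ 1+j<a a<1+j)) ,
    (λ _ → trans (miss k ks n j j<N 1+j≢a)
      (proj₂ (truncated-t-block n (k ∷ ks) j (ℕ.<⇒≤ j<N)) (ℕ.≤-pred a<1+j)))

  truncated-t≡nested : ∀ κ n → truncated-t N a κ (n ℕ.* N) ≡ nested x κ n
  truncated-t≡nested κ n = proj₁ (truncated-t-block n κ 0 z≤n) 0<a

-- The enumeration lists exactly the indices of given weight, depth and height

data HasMonomial : ℕ → ℕ → ℕ → List ℕ → Set
data HasAdmissibleMonomial : ℕ → ℕ → ℕ → ℕ × List ℕ → Set

data HasMonomial where
  empty : HasMonomial 0 0 0 []
  one   : ∀ {i j l κ} → HasMonomial i j l κ → HasMonomial i (suc j) l (1 ∷ κ)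
  big   : ∀ {i j l κ} → HasAdmissibleMonomial i j l κ → HasMonomial i j (suc (suc l)) (prepend κ)

data HasAdmissibleMonomial where
  two : ∀ {i j l κ} → HasMonomial i j l κ → HasAdmissibleMonomial i j l (2 , κ)
  inc : ∀ {i j l k ks} → HasAdmissibleMonomial i j l (k , ks) → HasAdmissibleMonomial (suc i) j l (suc k , ks)

-- The lists recurse on the exponents; the derivations obtained here let the statistics of an index
-- be computed by recursion on how it is built.
∈-indices⁻     : ∀ i j l {κ} → κ ∈ indices i j l → HasMonomial i j l κ
∈-ones⁻        : ∀ i j l {κ} → κ ∈ ones i j l → HasMonomial i j l κ
∈-bigs⁻        : ∀ i j l {κ} → κ ∈ bigs i j l → HasMonomial i j l κ
∈-admissibles⁻ : ∀ i j l {κ} → κ ∈ admissibles i j l → HasAdmissibleMonomial i j l κ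
∈-incremented⁻ : ∀ i j l {κ} → κ ∈ incremented i j l → HasAdmissibleMonomial i j l κ
∈-empties⁻     : ∀ i j l {κ} → κ ∈ empties i j l → HasMonomial i j l κ

∈-indices⁻ i j l κ∈ with Mem.∈-++⁻ (ones i j l) κ∈
... | inj₁ κ∈ones = ∈-ones⁻ i j l κ∈ones
... | inj₂ κ∈rest with Mem.∈-++⁻ (bigs i j l) κ∈rest
...   | inj₁ κ∈bigs    = ∈-bigs⁻ i j l κ∈bigs
...   | inj₂ κ∈empties = ∈-empties⁻ i j l κ∈empties

∈-ones⁻ i (suc j) l κ∈ with Mem.∈-map⁻ (1 ∷_) κ∈
... | _ , κ′∈ , refl = one (∈-indices⁻ i j l κ′∈)

∈-bigs⁻ i j (suc (suc l)) κ∈ with Mem.∈-map⁻ prepend κ∈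
... | _ , κ′∈ , refl = big (∈-admissibles⁻ i j l κ′∈)

∈-admissibles⁻ i j l κ∈ with Mem.∈-++⁻ (List.map (2 ,_) (indices i j l)) κ∈
... | inj₂ κ∈incremented = ∈-incremented⁻ i j l κ∈incremented
... | inj₁ κ∈twos with Mem.∈-map⁻ (2 ,_) κ∈twos
...   | _ , κ′∈ , refl = two (∈-indices⁻ i j l κ′∈)

∈-incremented⁻ (suc i) j l κ∈ with Mem.∈-map⁻ increment κ∈
... | _ , κ′∈ , refl = inc (∈-admissibles⁻ i j l κ′∈)

∈-empties⁻ zero zero zero (here refl) = empty

∈-indices⁺     : ∀ {i j l κ} → HasMonomial i j l κ → κ ∈ indices i j l
∈-admissibles⁺ : ∀ {i j l κ} → HasAdmissibleMonomial i j l κ → κ ∈ admissibles i j l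

∈-indices⁺ empty = here refl
∈-indices⁺ (one h) = Mem.∈-++⁺ˡ (Mem.∈-map⁺ (1 ∷_) (∈-indices⁺ h))
∈-indices⁺ {i} {j} {suc (suc l)} (big h) = Mem.∈-++⁺ʳ (ones i j (suc (suc l)))
  (Mem.∈-++⁺ˡ (Mem.∈-map⁺ prepend (∈-admissibles⁺ h)))

∈-admissibles⁺ (two h) = Mem.∈-++⁺ˡ (Mem.∈-map⁺ (2 ,_) (∈-indices⁺ h))
∈-admissibles⁺ {suc i} {j} {l} (inc h) =
  Mem.∈-++⁺ʳ (List.map (2 ,_) (indices (suc i) j l)) (Mem.∈-map⁺ increment (∈-admissibles⁺ h))

head≥2 : ∀ {i j l k ks} → HasAdmissibleMonomial i j l (k , ks) → 2 ≤ k
head≥2 (two _) = s≤s (s≤s z≤n)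
head≥2 (inc h) = ℕ.m≤n⇒m≤1+n (head≥2 h)

bigs-head : ∀ i j l {k ks} → k ∷ ks ∈ bigs i j l → 2 ≤ k
bigs-head i j (suc (suc l)) κ∈ with Mem.∈-map⁻ prepend κ∈
... | _ , κ′∈ , refl = head≥2 (∈-admissibles⁻ i j l κ′∈)

[]∉bigs : ∀ i j l → ¬ [] ∈ bigs i j l
[]∉bigs i j (suc (suc l)) []∈ with Mem.∈-map⁻ prepend []∈
... | _ , _ , ()

∷∉empties : ∀ i j l {k ks} → ¬ k ∷ ks ∈ empties i j l
∷∉empties zero zero zero (here ())
∷∉empties zero zero zero (there ())

-- The pieces are disjoint by their first entry: it is 1, at least 2 or absent for indices, and 2 or
-- at least 3 for admissible ones.
indices-unique     : ∀ i j l → Unique (indices i j l)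
ones-unique        : ∀ i j l → Unique (ones i j l)
bigs-unique        : ∀ i j l → Unique (bigs i j l)
admissibles-unique : ∀ i j l → Unique (admissibles i j l)
incremented-unique : ∀ i j l → Unique (incremented i j l)
empties-unique     : ∀ i j l → Unique (empties i j l)

indices-unique i j l = Unique.++⁺ (ones-unique i j l)
  (Unique.++⁺ (bigs-unique i j l) (empties-unique i j l) bigs∩empties)
  (ones∩rest j)
  where
  bigs∩empties : ∀ {κ} → ¬ (κ ∈ bigs i j l × κ ∈ empties i j l)
  bigs∩empties {[]}     (∈bigs , _)    = []∉bigs i j l ∈bigs
  bigs∩empties {k ∷ ks} (_ , ∈empties) = ∷∉empties i j l ∈empties

  ones∩rest : ∀ j {κ} → ¬ (κ ∈ ones i j l × κ ∈ bigs i j l ++ empties i j l)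
  ones∩rest (suc j) (∈ones , ∈rest) with Mem.∈-map⁻ (1 ∷_) ∈ones
  ... | _ , _ , refl with Mem.∈-++⁻ (bigs i (suc j) l) ∈rest
  ...   | inj₁ ∈bigs    = ℕ.<-irrefl refl (bigs-head i (suc j) l ∈bigs)
  ...   | inj₂ ∈empties = ∷∉empties i (suc j) l ∈empties

ones-unique i zero    l = []
ones-unique i (suc j) l = Unique.map⁺ List.∷-injectiveʳ (indices-unique i j l)

bigs-unique i j zero          = []
bigs-unique i j (suc zero)    = []
bigs-unique i j (suc (suc l)) = Unique.map⁺ (λ { refl → refl }) (admissibles-unique i j l)

admissibles-unique i j l = Unique.++⁺ (Unique.map⁺ (λ { refl → refl }) (indices-unique i j l))
  (incremented-unique i j l) (twos∩incremented i)
  where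
  twos∩incremented : ∀ i {κ} → ¬ (κ ∈ List.map (2 ,_) (indices i j l) × κ ∈ incremented i j l)
  twos∩incremented (suc i) (∈twos , ∈incremented) with Mem.∈-map⁻ (2 ,_) ∈twos
  ... | _ , _ , refl with Mem.∈-map⁻ increment ∈incremented
  ...   | _ , κ∈ , refl = ℕ.<-irrefl refl (head≥2 (∈-admissibles⁻ i j l κ∈))

incremented-unique zero    j l = []
incremented-unique (suc i) j l = Unique.map⁺ (λ { refl → refl }) (admissibles-unique i j l)

empties-unique zero    zero    zero    = [] ∷ []
empties-unique zero    zero    (suc l) = []
empties-unique zero    (suc j) l       = []
empties-unique (suc i) j       l       = []

height-≥2 : ∀ {k} ks → 2 ≤ k → height (k ∷ ks) ≡ suc (height ks)
height-≥2 ks 2≤k = cong length (List.filter-accept (2 ℕ.≤?_) {xs = ks} 2≤k)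

-- The exponent equations i = k - n - s, j = n - s and l = 2s, solved so that no truncated
-- subtraction occurs.
record Statistics (i j l : ℕ) (κ : List ℕ) : Set where
  constructor statistics
  field
    isIndex  : IsIndex κ
    weight-≡ : weight κ ≡ i ℕ.+ length κ ℕ.+ height κ
    length-≡ : length κ ≡ j ℕ.+ height κ
    height-≡ : l ≡ height κ ℕ.* 2

hasMonomial⇒statistics   : ∀ {i j l κ} → HasMonomial i j l κ → Statistics i j l κ
-- The two additional units of l restore the w² that an admissible head is not charged.
hasAdmissible⇒statistics : ∀ {i j l k ks} → HasAdmissibleMonomial i j l (k , ks) →
                           Statistics i j (suc (suc l)) (k ∷ ks)

hasMonomial⇒statistics empty = statistics [] refl refl refl
hasMonomial⇒statistics {i} (one {κ = κ} h) with hasMonomial⇒statistics h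
... | statistics index weight≡ length≡ height≡ = statistics (_ ∷ index)
  (trans (cong suc weight≡) (cong (ℕ._+ height κ) (sym (ℕ.+-suc i (length κ))))) (cong suc length≡) height≡
hasMonomial⇒statistics (big h) = hasAdmissible⇒statistics h

hasAdmissible⇒statistics {i} {j} (two {κ = κ} h) with hasMonomial⇒statistics h
... | statistics index weight≡ length≡ height≡ = statistics (_ ∷ index)
  (trans (cong (2 ℕ.+_) weight≡) (lemma i (length κ) (height κ)))
  (trans (cong suc length≡) (sym (ℕ.+-suc j (height κ)))) (cong (2 ℕ.+_) height≡)
  where
  lemma : ∀ i n h → 2 ℕ.+ (i ℕ.+ n ℕ.+ h) ≡ i ℕ.+ suc n ℕ.+ suc h
  lemma = solve-∀
hasAdmissible⇒statistics {suc i} {j} {l} {suc k} {ks} (inc h) with hasAdmissible⇒statistics h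
... | statistics (_ ∷ index) weight≡ length≡ height≡ = statistics (_ ∷ index)
  (cong suc (trans weight≡ (cong (i ℕ.+ suc (length ks) ℕ.+_) height-k)))
  (trans length≡ (cong (j ℕ.+_) height-k)) (trans height≡ (cong (ℕ._* 2) height-k))
  where
  height-k : height (k ∷ ks) ≡ height (suc k ∷ ks)
  height-k = trans (height-≥2 ks (head≥2 h)) (sym (height-≥2 ks (head≥2 (inc h))))

hasAdmissible-+ : ∀ e {i j l ks} → HasMonomial i j l ks → HasAdmissibleMonomial (e ℕ.+ i) j l (e ℕ.+ 2 , ks)
hasAdmissible-+ zero    h = two h
hasAdmissible-+ (suc e) h = inc (hasAdmissible-+ e h)

hasMonomial   : ∀ {κ} → IsIndex κ → ∃[ i ] ∃[ j ] ∃[ l ] HasMonomial i j l κ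
hasAdmissible : ∀ {k ks} → 1 < k → IsIndex ks → ∃[ i ] ∃[ j ] ∃[ l ] HasAdmissibleMonomial i j l (k , ks)

hasMonomial {[]} [] = 0 , 0 , 0 , empty
hasMonomial {suc zero ∷ ks} (_ ∷ index) with hasMonomial index
... | i , j , l , h = i , suc j , l , one h
hasMonomial {suc (suc e) ∷ ks} (_ ∷ index) with hasAdmissible (s≤s (s≤s z≤n)) index
... | i , j , l , h = i , j , suc (suc l) , big h

hasAdmissible {suc (suc e)} {ks} _ index with hasMonomial index
... | i , j , l , h = e ℕ.+ i , j , l ,
  subst (λ k → HasAdmissibleMonomial (e ℕ.+ i) j l (k , ks)) (ℕ.+-comm e 2) (hasAdmissible-+ e h)
hasAdmissible {suc zero} (s≤s ())

entries≤weight : ∀ κ → All (_≤ weight κ) κ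
entries≤weight []       = []
entries≤weight (k ∷ ks) = ℕ.m≤m+n k (weight ks) ∷
  All.map (λ k′≤ → ℕ.≤-trans k′≤ (ℕ.m≤n+m (weight ks) k)) (entries≤weight ks)

∈-words⁺ : ∀ {A : Set} {xs : List A} {ys} → All (_∈ xs) ys → ys ∈ words (length ys) xs
∈-words⁺ []         = here refl
∈-words⁺ (y∈ ∷ ys∈) = Mem.∈-cartesianProductWith⁺ _∷_ y∈ (∈-words⁺ ys∈)

words-unique : ∀ {A : Set} n {xs : List A} → Unique xs → Unique (words n xs)
words-unique zero    xs! = [] ∷ []
words-unique (suc n) xs! = Unique.cartesianProductWith⁺ _∷_ (λ { refl → refl , refl }) xs! (words-unique n xs!)

I₀-unique : ∀ k n s → Unique (I₀ k n s)
I₀-unique k n s = Unique.filter⁺ (isI₀? k n s) (words-unique n (Unique.upTo⁺ (suc k)))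

∈-I₀⁺ : ∀ {k n s κ} → IsI₀ k n s κ → κ ∈ I₀ k n s
∈-I₀⁺ {k} {n} {s} {κ} κ∈I₀@(_ , refl , refl , _) = Mem.∈-filter⁺ (isI₀? k n s)
  (∈-words⁺ (All.map (λ ≤weight → Mem.∈-upTo⁺ (s≤s ≤weight)) (entries≤weight κ))) κ∈I₀

∈-I₀⁻ : ∀ {k n s κ} → κ ∈ I₀ k n s → IsI₀ k n s κ
∈-I₀⁻ {k} {n} {s} κ∈ = proj₂ (Mem.∈-filter⁻ (isI₀? k n s) {xs = words n (upTo (suc k))} κ∈)

module Enumeration (i j h : ℕ) where
  private
    s n k : ℕ
    s = suc h
    n = j ℕ.+ s
    k = i ℕ.+ n ℕ.+ s

  -- Every admissible index has some exponents; its weight, depth and height then force them to be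
  -- i, j and 2h.
  I₀⇒admissibles : ∀ {κ} → κ ∈ I₀ k n s → κ ∈ List.map prepend (admissibles i j (h ℕ.* 2))
  I₀⇒admissibles {[]} κ∈ with ∈-I₀⁻ {k} {n} {s} κ∈
  ... | () , _
  I₀⇒admissibles {k′ ∷ ks} κ∈ with ∈-I₀⁻ {k} {n} {s} κ∈
  ... | (1<k′ , index) , refl-w , refl-n , refl-s with hasAdmissible 1<k′ index
  ... | i′ , j′ , l′ , hasMon with hasAdmissible⇒statistics hasMon
  ... | statistics _ weight≡ length≡ height≡ = Mem.∈-map⁺ prepend
    (subst (λ (i , j , l) → (k′ , ks) ∈ admissibles i j l) (cong₂ _,_ i′≡i (cong₂ _,_ j′≡j l′≡2h))
      (∈-admissibles⁺ hasMon))
    where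
    i′≡i : i′ ≡ i
    i′≡i = ℕ.+-cancelʳ-≡ n i′ i (ℕ.+-cancelʳ-≡ s (i′ ℕ.+ n) (i ℕ.+ n)
      (trans (cong₂ (λ n s → i′ ℕ.+ n ℕ.+ s) (sym refl-n) (sym refl-s)) (trans (sym weight≡) refl-w)))
    j′≡j : j′ ≡ j
    j′≡j = ℕ.+-cancelʳ-≡ s j′ j (trans (cong (j′ ℕ.+_) (sym refl-s)) (trans (sym length≡) refl-n))
    l′≡2h : l′ ≡ h ℕ.* 2
    l′≡2h = ℕ.suc-injective (ℕ.suc-injective (trans height≡ (cong (ℕ._* 2) refl-s)))

  admissibles⇒I₀ : ∀ {κ} → κ ∈ List.map prepend (admissibles i j (h ℕ.* 2)) → κ ∈ I₀ k n s
  admissibles⇒I₀ κ∈ with Mem.∈-map⁻ prepend κ∈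
  ... | (k′ , ks) , κ′∈ , refl with ∈-admissibles⁻ i j (h ℕ.* 2) κ′∈
  ... | hasMon with hasAdmissible⇒statistics hasMon
  ... | statistics (_ ∷ index) weight≡ length≡ height≡ = ∈-I₀⁺ ((head≥2 hasMon , index) ,
    trans weight≡ (cong₂ (λ n s → i ℕ.+ n ℕ.+ s) n≡ s≡) , n≡ , s≡)
    where
    s≡ : height (k′ ∷ ks) ≡ s
    s≡ = sym (ℕ.*-cancelʳ-≡ s (height (k′ ∷ ks)) 2 height≡)
    n≡ : length (k′ ∷ ks) ≡ n
    n≡ = trans length≡ (cong (j ℕ.+_) s≡)

  -- Sums over lists count multiplicities, so equal membership must be combined with the absence of
  -- repetitions in both lists.
  I₀-↭ : I₀ k n s ↭ List.map prepend (admissibles i j (h ℕ.* 2))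
  I₀-↭ = ∼bag⇒↭ (unique∧set⇒bag (I₀-unique k n s)
    (Unique.map⁺ (λ { refl → refl }) (admissibles-unique i j (h ℕ.* 2)))
    (mk⇔ I₀⇒admissibles admissibles⇒I₀))

∈-admissibles⇒2∣ : ∀ {i j l κ} → κ ∈ admissibles i j l → 2 ℕ.∣ l
∈-admissibles⇒2∣ {i} {j} {l} {k , ks} κ∈ =
  ℕ.∣m+n∣m⇒∣n (ℕ.divides (height (k ∷ ks)) (Statistics.height-≡ (hasAdmissible⇒statistics (∈-admissibles⁻ i j l κ∈))))
    ℕ.∣-refl

-- Partial sums and convergence

Σℚ-↭ : ∀ {A : Set} (f : A → ℚ) {xs ys} → xs ↭ ys → Σℚ f xs ≡ Σℚ f ys
Σℚ-↭ f xs↭ys = ↭ₛ.foldr-commMonoid (≡.setoid ℚ) ℚ.+-0-isCommutativeMonoid (↭⇒↭ₛ (↭.map⁺ f xs↭ys))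

open RawSemiringOps 𝕊.rawSemiring using () renaming (sum to Σ𝕊)

-- `Σ𝕊` peels off its first term, so the induction shifts `T` and `S` together, and for this `S 0`
-- has to be arbitrary.
partial-sum : ∀ i j l d (T : ℕ → Series) (S : ℕ → ℚ) →
  (∀ n → S (suc n) ≡ S n ℚ.+ T n ⟪ i , j , l , d ⟫) → ∀ M →
  S 0 ℚ.+ Σ𝕊 {M} (λ m → T (toℕ m)) ⟪ i , j , l , d ⟫ ≡ S M
partial-sum i j l d T S step zero    = ℚ.+-identityʳ (S 0)
partial-sum i j l d T S step (suc M) = trans
  (cong (S 0 ℚ.+_) (+-coeff (T 0) rest i j l d))
  (trans (sym (ℚ.+-assoc (S 0) (T 0 ⟪ i , j , l , d ⟫) (rest ⟪ i , j , l , d ⟫)))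
  (trans (cong (ℚ._+ rest ⟪ i , j , l , d ⟫) (sym (step 0)))
    (partial-sum i j l d (λ n → T (suc n)) (λ n → S (suc n)) (λ n → step (suc n)) M)))
  where rest = Σ𝕊 {M} (λ m → T (suc (toℕ m)))

-- As φ M ≥ M, both compared indices lie beyond the Cauchy threshold of `y`.
subsequence-⟶ : ∀ {q} y (φ : ℕ → ℕ) → (∀ M → M ≤ φ M) → (∀ M → approx y (φ M) ≡ q M) → q ⟶ y
subsequence-⟶ {q} y φ M≤φM y∘φ≗q ε 0<ε with isCauchy y ε 0<ε
... | K , close = K , λ M n K≤M K≤n → subst (λ p → ℚ.∣ p ℚ.- approx y n ∣ ℚ.< ε) (y∘φ≗q M)
  (close (φ M) n (ℕ.≤-trans K≤M (M≤φM M)) K≤n)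

module _ (N a : ℕ) .{{_ : NonZero N}} where

  approx-tʳ : ∀ {k ls} (adm : Admissible (k ∷ ls)) d m →
    approx (coeff 0ℝ (tʳ N a adm) d) m ≡ merge (λ p → truncated-t N a p m) k ls d
  approx-tʳ {k} {ls} adm d m = trans
    (approx-Σ (λ {p} adm-p → monomial 0ℝ (suc (length ls) ∸ length p) (t N a adm-p))
      (λ p → coeff 0ℚ (monomial 0ℚ (suc (length ls) ∸ length p) (truncated-t N a p m)) d) d m
      (λ {p} adm-p → approx-monomial (suc (length ls) ∸ length p) (t N a adm-p) d m)
      (merges-admissible adm))
    (merges-merge (λ p → truncated-t N a p m) k ls d)

  module _ .{{_ : NonZero a}} (a≤N : a ≤ N) where
    open Generating (reciprocal N a)

    approx-X₀ : ∀ k n s d M →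
      approx (coeff 0ℝ (X₀ N a k n s) d) (M ℕ.* N) ≡ Σℚ (λ κ → coeff 0ℚ (t< M κ) d) (I₀ k n s)
    approx-X₀ k n s d M = approx-Σ (λ κ∈I₀ → tʳ N a (proj₁ κ∈I₀)) (λ κ → coeff 0ℚ (t< M κ) d)
      d (M ℕ.* N) (λ {κ} κ∈I₀ → lemma κ (proj₁ κ∈I₀)) (I₀-sound k n s)
      where
      lemma : ∀ κ (adm : Admissible κ) → approx (coeff 0ℝ (tʳ N a adm) d) (M ℕ.* N) ≡ coeff 0ℚ (t< M κ) d
      lemma (k ∷ ls) adm = trans (approx-tʳ adm d (M ℕ.* N))
        (trans (merge-cong (λ j js → Progression.truncated-t≡nested N a a≤N (j ∷ js) M) k ls d)
        (merge-nested (reciprocal N a) M k ls d))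

    S : ℕ → ℕ → ℕ → ℕ → ℕ → ℚ
    S i j l d M = Σℚ (λ κ → coeff 0ℚ (t< M (prepend κ)) d) (admissibles i j l)

    S-suc : ∀ i j l d M → S i j l d (suc M) ≡ S i j l d M ℚ.+ T M ⟪ i , j , l , d ⟫
    S-suc i j l d M = trans
      (Σℚ-cong (λ κ → coeff-add (t< M (prepend κ)) (t= M (prepend κ)) d) κs)
      (trans (Σℚ-+ (λ κ → coeff 0ℚ (t< M (prepend κ)) d) (λ κ → coeff 0ℚ (t= M (prepend κ)) d) κs)
      (cong (S i j l d M ℚ.+_) (sym (coeff-Σ (λ κ → t= M (prepend κ)) κs d))))
      where κs = admissibles i j l

    -- The sum telescopes from `S` at 0, which vanishes because an admissible index is nonempty and
    -- no variable lies below m₀.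
    sum-T : ∀ i j l d M →
      Σ𝕊 {M} (λ m → T (toℕ m)) ⟪ i , j , l , d ⟫ ≡ S i j l d M
    sum-T i j l d M = trans (sym (ℚ.+-identityˡ total))
      (trans (cong (ℚ._+ total) (sym (Σℚ-zero (admissibles i j l))))
        (partial-sum i j l d T (S i j l d) (S-suc i j l d) M))
      where total = Σ𝕊 {M} (λ m → T (toℕ m)) ⟪ i , j , l , d ⟫

    ⌊h*2/2⌋ : ∀ h → ⌊ h ℕ.* 2 /2⌋ ≡ h
    ⌊h*2/2⌋ zero    = refl
    ⌊h*2/2⌋ (suc h) = cong suc (⌊h*2/2⌋ h)

    generatingSeries-even : ∀ i j l → 2 ℕ.∣ l → let s = suc ⌊ l /2⌋ in
      generatingSeries N a i j l ≡ X₀ N a (i ℕ.+ (j ℕ.+ s) ℕ.+ s) (j ℕ.+ s) s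
    generatingSeries-even i j l 2∣l =
      cong (λ b → if b then X₀ N a (i ℕ.+ (j ℕ.+ s) ℕ.+ s) (j ℕ.+ s) s else []) (dec-true (2 ℕ.∣? l) 2∣l)
      where s = suc ⌊ l /2⌋

    generatingSeries-odd : ∀ i j l → ¬ 2 ℕ.∣ l → generatingSeries N a i j l ≡ []
    generatingSeries-odd i j l 2∤l =
      cong (λ b → if b then X₀ N a (i ℕ.+ (j ℕ.+ s) ℕ.+ s) (j ℕ.+ s) s else []) (dec-false (2 ℕ.∣? l) 2∤l)
      where s = suc ⌊ l /2⌋

    S-odd : ∀ i j l d M → ¬ 2 ℕ.∣ l → S i j l d M ≡ 0ℚ
    S-odd i j l d M 2∤l = lemma (admissibles i j l) (λ κ∈ → 2∤l (∈-admissibles⇒2∣ {i} {j} κ∈))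
      where
      lemma : ∀ κs → (∀ {κ} → ¬ κ ∈ κs) → Σℚ (λ κ → coeff 0ℚ (t< M (prepend κ)) d) κs ≡ 0ℚ
      lemma []       _  = refl
      lemma (κ ∷ κs) ∉κs = contradiction (here refl) ∉κs

    Σ-I₀ : ∀ i j h l d M → l ≡ h ℕ.* 2 → let s = suc ⌊ l /2⌋ in
      Σℚ (λ κ → coeff 0ℚ (t< M κ) d) (I₀ (i ℕ.+ (j ℕ.+ s) ℕ.+ s) (j ℕ.+ s) s) ≡ S i j l d M
    Σ-I₀ i j h l d M refl = trans
      (cong (λ h′ → Σℚ f (I₀ (i ℕ.+ (j ℕ.+ suc h′) ℕ.+ suc h′) (j ℕ.+ suc h′) (suc h′))) (⌊h*2/2⌋ h))
      (trans (Σℚ-↭ f (Enumeration.I₀-↭ i j h)) (Σℚ-map f prepend (admissibles i j (h ℕ.* 2))))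
      where
      f : List ℕ → ℚ
      f κ = coeff 0ℚ (t< M κ) d

    -- Because 0 < a ≤ N, the cutoff M N admits exactly the variables m₀, ..., m_(M-1). At multiples
    -- of N the approximations are therefore equal to the partial sums, and convergence reduces to
    -- passing to a subsequence.
    approx-generatingSeries : ∀ i j l d M →
      approx (coeff 0ℝ (generatingSeries N a i j l) d) (M ℕ.* N) ≡ S i j l d M
    approx-generatingSeries i j l d M = by-parity (2 ℕ.∣? l)
      where
      by-parity : Dec (2 ℕ.∣ l) → approx (coeff 0ℝ (generatingSeries N a i j l) d) (M ℕ.* N) ≡ S i j l d M
      by-parity (yes 2∣l@(ℕ.divides h l≡2h)) = trans
        (cong (λ p → approx (coeff 0ℝ p d) (M ℕ.* N)) (generatingSeries-even i j l 2∣l))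
        (trans (approx-X₀ (i ℕ.+ (j ℕ.+ suc ⌊ l /2⌋) ℕ.+ suc ⌊ l /2⌋) (j ℕ.+ suc ⌊ l /2⌋) (suc ⌊ l /2⌋) d M)
          (Σ-I₀ i j h l d M l≡2h))
      by-parity (no 2∤l) = trans
        (cong (λ p → approx (coeff 0ℝ p d) (M ℕ.* N)) (generatingSeries-odd i j l 2∤l))
        (sym (S-odd i j l d M 2∤l))

    T-sumsTo : T SumsTo generatingSeries N a
    T-sumsTo i j l d = subsequence-⟶ (coeff 0ℝ (generatingSeries N a i j l) d) (ℕ._* N)
      (λ M → ℕ.m≤m*n M N)
      (λ M → trans (approx-generatingSeries i j l d M) (sym (sum-T i j l d M)))

theorem2p1 : ∀ {c ℓ} (N a : ℕ) .{{_ : NonZero N}} → 1 ≤ a → a ≤ N → (P : Parameters c ℓ) →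
    ∃[ T ] (∀ n → IsTerm N a P n (T n)) × T SumsTo generatingSeries N a
theorem2p1 N a 1≤a a≤N P =
  Generating.T (reciprocal N a) , Terms.isTerm N a P , T-sumsTo N a a≤N
  where instance _ = ℕ.>-nonZero 1≤a
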